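{- Let $G$ be a finite abstract simplicial complex with $n$ elements and let $L$ be its $n\times n$ connection matrix. Let $\lambda_1\ge\lambda_2\ge\cdots\ge\lambda_n$ be the eigenvalues of $L$ (with multiplicity) in descending order, and let $d_1\ge d_2\ge\cdots\ge d_n$ be the connection degrees $d(x)$, $x\in G$, in descending order. Then $\lambda_j\le d_j$ for all $1\le j\le n$.
   Context: A finite abstract simplicial complex $G$ is a finite set of non-empty finite sets (simplices) closed under taking non-empty subsets. The dimension of $x \in G$ is $\dim(x)=|x|-1$, and $\omega(x)=(-1)^{\dim(x)}$. For $A\subset G$, $\chi(A)=\sum_{x\in A}\omega(x)$ (so $\chi(\emptyset)=0$). For $x\in G$, $C(x)=\{y\in G: y\subset x\}$. The connection matrix $L$ is the symmetric matrix indexed by $G\times G$ with $L(x,y)=\chi(C(x)\cap C(y))$, i.e. $L(x,y)=1$ if $x\cap y\ne\emptyset$ and $L(x,y)=0$ otherwise. The connection degree of $x\in G$ is $d(x)=|\{y\in G:\chi(C(x)\cap C(y))\ne 0\}|$, i.e. the number of $y\in G$ (including $y=x$) with $x\cap y\neq\emptyset$. -}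

module Defs where

open import Algebra.Bundles using (CommutativeRing; Semiring)
import Algebra.Definitions.RawMonoid as RawMonoidOps
import Algebra.Definitions.RawSemiring as RawSemiringOps
open import Data.Bool.Base using (if_then_else_)
open import Data.Fin.Base using (Fin; zero; suc; toℕ; punchIn)
import Data.Fin.Properties as Fin
open import Data.Fin.Subset using (Subset; Nonempty; _⊆_; _∩_; ∣_∣)
open import Data.Fin.Subset.Properties using (_⊆?_)
open import Data.Integer.Base as ℤ using (ℤ; 0ℤ; -1ℤ)
import Data.Integer.Properties as ℤ
open import Data.Nat.Base as ℕ using (ℕ; zero; suc; _∸_; _⊔_)
import Data.Nat.Properties as ℕ
open import Data.Product.Base using (_×_; _,_; ∃-syntax)
open import Data.Rational.Base as ℚ using (ℚ; 0ℚ; 1ℚ; ½)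
import Data.Rational.Properties as ℚ
open import Data.Rational.Solver using (module +-*-Solver)
open import Data.Vec.Base using (lookup; tabulate)
open import Data.Vec.Functional using (Vector)
open import Function.Definitions using (Injective)
open import Level using (0ℓ)
open import Relation.Binary.PropositionalEquality
open import Relation.Nullary.Decidable using (does; ¬?)

Matrix : ∀ {a} → Set a → ℕ → Set a
Matrix A n = Fin n → Fin n → A

module Determinant {c ℓ} (R : CommutativeRing c ℓ) where
  open CommutativeRing R using (Carrier; 0#; 1#; _*_; -_; _-_; semiring)
  open RawSemiringOps (Semiring.rawSemiring semiring) using (sum; _^_)

  det : ∀ {n} → Matrix Carrier n → Carrier
  det {zero}  A = 1#
  det {suc n} A = sum λ j →
    (- 1#) ^ toℕ j * A zero j * det (λ i k → A (suc i) (punchIn j k))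

  scalar : ∀ {n} → Carrier → Matrix Carrier n
  scalar t i j = if does (i Fin.≟ j) then t else 0#

  charPoly : ∀ {n} → Matrix Carrier n → Carrier → Carrier
  charPoly A t = det λ i j → scalar t i j - A i j

Eventually : (ℕ → Set) → Set
Eventually P = ∃[ N ] ∀ n → N ℕ.≤ n → P n

record ℝ : Set where
  constructor mkℝ
  field
    seq    : ℕ → ℚ
    cauchy : ∀ ε → 0ℚ ℚ.< ε →
             ∃[ N ] ∀ m n → N ℕ.≤ m → N ℕ.≤ n → ℚ.∣ seq m ℚ.- seq n ∣ ℚ.< ε

open ℝ public

infix 4 _≈_ _≤_

_≈_ : ℝ → ℝ → Set
x ≈ y = ∀ ε → 0ℚ ℚ.< ε → Eventually λ n → ℚ.∣ seq x n ℚ.- seq y n ∣ ℚ.< ε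

_≤_ : ℝ → ℝ → Set
x ≤ y = ∀ ε → 0ℚ ℚ.< ε → Eventually λ n → seq x n ℚ.≤ seq y n ℚ.+ ε

fromℚ : ℚ → ℝ
fromℚ q = mkℝ (λ _ → q) λ ε 0<ε →
  0 , λ _ _ _ _ → subst (ℚ._< ε) (sym (cong ℚ.∣_∣ (ℚ.+-inverseʳ q))) 0<ε

fromℤ : ℤ → ℝ
fromℤ z = fromℚ (z ℚ./ 1)

fromℕ : ℕ → ℝ
fromℕ n = fromℤ (ℤ.+ n)

module _ where
  open ℚ.≤-Reasoning
  open +-*-Solver

  eventually₂ : ∀ {P Q R : ℕ → Set} → (∀ {n} → P n → Q n → R n) →
                Eventually P → Eventually Q → Eventually R
  eventually₂ f (M , p) (N , q) = M ⊔ N , λ n M⊔N≤n →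
    f (p n (ℕ.m⊔n≤o⇒m≤o M N M⊔N≤n)) (q n (ℕ.m⊔n≤o⇒n≤o M N M⊔N≤n))

  0<½* : ∀ {ε} → 0ℚ ℚ.< ε → 0ℚ ℚ.< ½ ℚ.* ε
  0<½* {ε} 0<ε = subst (ℚ._< ½ ℚ.* ε) (ℚ.*-zeroʳ ½) (ℚ.*-monoʳ-<-pos ½ 0<ε)

  ½+½ : ∀ ε → ½ ℚ.* ε ℚ.+ ½ ℚ.* ε ≡ ε
  ½+½ = solve 1 (λ e → con ½ :* e :+ con ½ :* e := e) refl

  +-small : ∀ {p q r ε} → r ≡ p ℚ.+ q → ℚ.∣ p ∣ ℚ.< ½ ℚ.* ε → ℚ.∣ q ∣ ℚ.< ½ ℚ.* ε →
            ℚ.∣ r ∣ ℚ.< ε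
  +-small {p} {q} {r} {ε} r≡p+q p< q< = begin-strict
    ℚ.∣ r ∣                  ≡⟨ cong ℚ.∣_∣ r≡p+q ⟩
    ℚ.∣ p ℚ.+ q ∣            ≤⟨ ℚ.∣p+q∣≤∣p∣+∣q∣ p q ⟩
    ℚ.∣ p ∣ ℚ.+ ℚ.∣ q ∣      <⟨ ℚ.+-mono-< p< q< ⟩
    ½ ℚ.* ε ℚ.+ ½ ℚ.* ε      ≡⟨ ½+½ ε ⟩
    ε                        ∎

  scale : ∀ B ε → 0ℚ ℚ.< B → 0ℚ ℚ.< ε → ∃[ δ ] 0ℚ ℚ.< δ × B ℚ.* δ ≡ ε
  scale B ε 0<B 0<ε = B⁻¹ ℚ.* ε , 0<δ , eq
    where
    instance
      B-pos : ℚ.Positive B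
      B-pos = ℚ.positive 0<B
      B-nz : ℚ.NonZero B
      B-nz = ℚ.pos⇒nonZero B
    B⁻¹ = ℚ.1/ B
    instance
      B⁻¹-pos : ℚ.Positive B⁻¹
      B⁻¹-pos = ℚ.1/pos⇒pos B
    0<δ : 0ℚ ℚ.< B⁻¹ ℚ.* ε
    0<δ = subst (ℚ._< B⁻¹ ℚ.* ε) (ℚ.*-zeroʳ B⁻¹) (ℚ.*-monoʳ-<-pos B⁻¹ 0<ε)
    eq : B ℚ.* (B⁻¹ ℚ.* ε) ≡ ε
    eq = trans (sym (ℚ.*-assoc B B⁻¹ ε))
               (trans (cong (ℚ._* ε) (ℚ.*-inverseʳ B)) (ℚ.*-identityˡ ε))

  *-small : ∀ {p q B δ ε} → 0ℚ ℚ.< B → B ℚ.* δ ≡ ε → ℚ.∣ p ∣ ℚ.≤ B → ℚ.∣ q ∣ ℚ.< δ →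
            ℚ.∣ p ℚ.* q ∣ ℚ.< ε
  *-small {p} {q} {B} {δ} {ε} 0<B Bδ≡ε p≤ q< = begin-strict
    ℚ.∣ p ℚ.* q ∣            ≡⟨ ℚ.∣p*q∣≡∣p∣*∣q∣ p q ⟩
    ℚ.∣ p ∣ ℚ.* ℚ.∣ q ∣      ≤⟨ ℚ.*-monoʳ-≤-nonNeg ℚ.∣ q ∣ {{ℚ.∣-∣-nonNeg q}} p≤ ⟩
    B ℚ.* ℚ.∣ q ∣            <⟨ ℚ.*-monoʳ-<-pos B {{ℚ.positive 0<B}} q< ⟩
    B ℚ.* δ                  ≡⟨ Bδ≡ε ⟩
    ε                        ∎

  bounded : ∀ x → ∃[ B ] 0ℚ ℚ.< B × Eventually λ n → ℚ.∣ seq x n ∣ ℚ.≤ B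
  bounded x with cauchy x 1ℚ (ℚ.positive⁻¹ 1ℚ)
  ... | N , near = B , 0<B , N , bound
    where
    B = ℚ.∣ seq x N ∣ ℚ.+ 1ℚ
    0<B : 0ℚ ℚ.< B
    0<B = ℚ.+-mono-≤-< (ℚ.0≤∣p∣ (seq x N)) (ℚ.positive⁻¹ 1ℚ)
    bound : ∀ n → N ℕ.≤ n → ℚ.∣ seq x n ∣ ℚ.≤ B
    bound n N≤n = begin
      ℚ.∣ seq x n ∣
        ≡⟨ cong ℚ.∣_∣ (solve 2 (λ a b → a := b :+ (a :- b)) refl (seq x n) (seq x N)) ⟩
      ℚ.∣ seq x N ℚ.+ (seq x n ℚ.- seq x N) ∣
        ≤⟨ ℚ.∣p+q∣≤∣p∣+∣q∣ (seq x N) (seq x n ℚ.- seq x N) ⟩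
      ℚ.∣ seq x N ∣ ℚ.+ ℚ.∣ seq x n ℚ.- seq x N ∣
        ≤⟨ ℚ.+-monoʳ-≤ ℚ.∣ seq x N ∣ (ℚ.<⇒≤ (near n N N≤n ℕ.≤-refl)) ⟩
      B ∎

  ∣p-q∣≡∣q-p∣ : ∀ p q → ℚ.∣ p ℚ.- q ∣ ≡ ℚ.∣ q ℚ.- p ∣
  ∣p-q∣≡∣q-p∣ p q = trans (cong ℚ.∣_∣ (solve 2 (λ a b → a :- b := :- (b :- a)) refl p q))
                          (ℚ.∣-p∣≡∣p∣ (q ℚ.- p))

  infixl 6 _+_
  infixl 7 _*_
  infix  8 -_

  _+_ : ℝ → ℝ → ℝ
  x + y = mkℝ (λ n → seq x n ℚ.+ seq y n) λ ε 0<ε →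
    let M , p = cauchy x (½ ℚ.* ε) (0<½* 0<ε)
        N , q = cauchy y (½ ℚ.* ε) (0<½* 0<ε)
    in M ⊔ N , λ m n hm hn →
      +-small {ε = ε}
        (solve 4 (λ a b c d → (a :+ b) :- (c :+ d) := (a :- c) :+ (b :- d)) refl
           (seq x m) (seq y m) (seq x n) (seq y n))
        (p m n (ℕ.m⊔n≤o⇒m≤o M N hm) (ℕ.m⊔n≤o⇒m≤o M N hn))
        (q m n (ℕ.m⊔n≤o⇒n≤o M N hm) (ℕ.m⊔n≤o⇒n≤o M N hn))

  -_ : ℝ → ℝ
  - x = mkℝ (λ n → ℚ.- seq x n) λ ε 0<ε →
    let N , p = cauchy x ε 0<ε
    in N , λ m n hm hn → subst (ℚ._< ε)
      (trans (sym (ℚ.∣-p∣≡∣p∣ (seq x m ℚ.- seq x n)))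
             (cong ℚ.∣_∣ (solve 2 (λ a b → :- (a :- b) := (:- a) :- (:- b)) refl
                            (seq x m) (seq x n))))
      (p m n hm hn)

  _*_ : ℝ → ℝ → ℝ
  x * y = mkℝ (λ n → seq x n ℚ.* seq y n) λ ε 0<ε →
    let B , 0<B , K , x≤B = bounded x
        C , 0<C , L , y≤C = bounded y
        δ , 0<δ , Bδ = scale B (½ ℚ.* ε) 0<B (0<½* 0<ε)
        η , 0<η , Cη = scale C (½ ℚ.* ε) 0<C (0<½* 0<ε)
        M , p = cauchy y δ 0<δ
        N , q = cauchy x η 0<η
        KL = K ⊔ L
        MN = M ⊔ N
    in KL ⊔ MN , λ m n hm hn →
      let hm₁ = ℕ.m⊔n≤o⇒m≤o KL MN hm
          hm₂ = ℕ.m⊔n≤o⇒n≤o KL MN hm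
          hn₁ = ℕ.m⊔n≤o⇒m≤o KL MN hn
          hn₂ = ℕ.m⊔n≤o⇒n≤o KL MN hn
      in +-small {ε = ε}
        (solve 4 (λ a b c d → a :* b :- c :* d := a :* (b :- d) :+ d :* (a :- c)) refl
           (seq x m) (seq y m) (seq x n) (seq y n))
        (*-small {p = seq x m} {q = seq y m ℚ.- seq y n} 0<B Bδ
           (x≤B m (ℕ.m⊔n≤o⇒m≤o K L hm₁))
           (p m n (ℕ.m⊔n≤o⇒m≤o M N hm₂) (ℕ.m⊔n≤o⇒m≤o M N hn₂)))
        (*-small {p = seq y n} {q = seq x m ℚ.- seq x n} 0<C Cη
           (y≤C n (ℕ.m⊔n≤o⇒n≤o K L hn₁))
           (q m n (ℕ.m⊔n≤o⇒n≤o M N hm₂) (ℕ.m⊔n≤o⇒n≤o M N hn₂)))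

  pointwise : ∀ x y → (∀ n → seq x n ≡ seq y n) → x ≈ y
  pointwise x y eq ε 0<ε = 0 , λ n _ → subst (ℚ._< ε)
    (sym (cong ℚ.∣_∣ (trans (cong (ℚ._- seq y n) (eq n)) (ℚ.+-inverseʳ (seq y n))))) 0<ε

  ≈-sym : ∀ {x y} → x ≈ y → y ≈ x
  ≈-sym {x} {y} x≈y ε 0<ε = let N , p = x≈y ε 0<ε in
    N , λ n h → subst (ℚ._< ε) (∣p-q∣≡∣q-p∣ (seq x n) (seq y n)) (p n h)

  ≈-trans : ∀ {x y z} → x ≈ y → y ≈ z → x ≈ z
  ≈-trans {x} {y} {z} x≈y y≈z ε 0<ε = eventually₂
    (λ {n} → +-small {ε = ε}
      (solve 3 (λ a b c → a :- c := (a :- b) :+ (b :- c)) refl (seq x n) (seq y n) (seq z n)))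
    (x≈y (½ ℚ.* ε) (0<½* 0<ε)) (y≈z (½ ℚ.* ε) (0<½* 0<ε))

  +-cong : ∀ {x x′ y y′} → x ≈ x′ → y ≈ y′ → x + y ≈ x′ + y′
  +-cong {x} {x′} {y} {y′} x≈x′ y≈y′ ε 0<ε = eventually₂
    (λ {n} → +-small {ε = ε}
      (solve 4 (λ a b c d → (a :+ b) :- (c :+ d) := (a :- c) :+ (b :- d)) refl
         (seq x n) (seq y n) (seq x′ n) (seq y′ n)))
    (x≈x′ (½ ℚ.* ε) (0<½* 0<ε)) (y≈y′ (½ ℚ.* ε) (0<½* 0<ε))

  -‿cong : ∀ {x x′} → x ≈ x′ → - x ≈ - x′
  -‿cong {x} {x′} x≈x′ ε 0<ε = let N , p = x≈x′ ε 0<ε in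
    N , λ n h → subst (ℚ._< ε)
      (trans (sym (ℚ.∣-p∣≡∣p∣ (seq x n ℚ.- seq x′ n)))
             (cong ℚ.∣_∣ (solve 2 (λ a b → :- (a :- b) := (:- a) :- (:- b)) refl
                            (seq x n) (seq x′ n))))
      (p n h)

  *-cong : ∀ {x x′ y y′} → x ≈ x′ → y ≈ y′ → x * y ≈ x′ * y′
  *-cong {x} {x′} {y} {y′} x≈x′ y≈y′ ε 0<ε =
    let B , 0<B , x≤B  = bounded x
        C , 0<C , y′≤C = bounded y′
        δ , 0<δ , Bδ = scale B (½ ℚ.* ε) 0<B (0<½* 0<ε)
        η , 0<η , Cη = scale C (½ ℚ.* ε) 0<C (0<½* 0<ε)
    in eventually₂
      (λ {n} → +-small {ε = ε}
        (solve 4 (λ a b c d → a :* b :- c :* d := a :* (b :- d) :+ d :* (a :- c)) refl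
           (seq x n) (seq y n) (seq x′ n) (seq y′ n)))
      (eventually₂ (λ {n} → *-small {p = seq x n} {q = seq y n ℚ.- seq y′ n} 0<B Bδ)
         x≤B (y≈y′ δ 0<δ))
      (eventually₂ (λ {n} → *-small {p = seq y′ n} {q = seq x n ℚ.- seq x′ n} 0<C Cη)
         y′≤C (x≈x′ η 0<η))

ℝ-commutativeRing : CommutativeRing 0ℓ 0ℓ
ℝ-commutativeRing = record
  { Carrier = ℝ
  ; _≈_ = _≈_
  ; _+_ = _+_
  ; _*_ = _*_
  ; -_  = -_
  ; 0#  = fromℚ 0ℚ
  ; 1#  = fromℚ 1ℚ
  ; isCommutativeRing = record
    { isRing = record
      { +-isAbelianGroup = record
        { isGroup = record
          { isMonoid = record
            { isSemigroup = record
              { isMagma = record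
                { isEquivalence = record
                  { refl  = λ {x} → pointwise x x λ _ → refl
                  ; sym   = λ {x} {y} → ≈-sym {x} {y}
                  ; trans = λ {x} {y} {z} → ≈-trans {x} {y} {z}
                  }
                ; ∙-cong = λ {x} {x′} {y} {y′} → +-cong {x} {x′} {y} {y′}
                }
              ; assoc = λ x y z → pointwise (x + y + z) (x + (y + z))
                  λ n → ℚ.+-assoc (seq x n) (seq y n) (seq z n)
              }
            ; identity = (λ x → pointwise (fromℚ 0ℚ + x) x λ n → ℚ.+-identityˡ (seq x n))
                       , (λ x → pointwise (x + fromℚ 0ℚ) x λ n → ℚ.+-identityʳ (seq x n))
            }
          ; inverse = (λ x → pointwise (- x + x) (fromℚ 0ℚ) λ n → ℚ.+-inverseˡ (seq x n))
                    , (λ x → pointwise (x + - x) (fromℚ 0ℚ) λ n → ℚ.+-inverseʳ (seq x n))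
          ; ⁻¹-cong = λ {x} {x′} → -‿cong {x} {x′}
          }
        ; comm = λ x y → pointwise (x + y) (y + x) λ n → ℚ.+-comm (seq x n) (seq y n)
        }
      ; *-cong = λ {x} {x′} {y} {y′} → *-cong {x} {x′} {y} {y′}
      ; *-assoc = λ x y z → pointwise (x * y * z) (x * (y * z))
          λ n → ℚ.*-assoc (seq x n) (seq y n) (seq z n)
      ; *-identity = (λ x → pointwise (fromℚ 1ℚ * x) x λ n → ℚ.*-identityˡ (seq x n))
                   , (λ x → pointwise (x * fromℚ 1ℚ) x λ n → ℚ.*-identityʳ (seq x n))
      ; distrib = (λ x y z → pointwise (x * (y + z)) (x * y + x * z)
                     λ n → ℚ.*-distribˡ-+ (seq x n) (seq y n) (seq z n))
                , (λ x y z → pointwise ((y + z) * x) (y * x + z * x)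
                     λ n → ℚ.*-distribʳ-+ (seq x n) (seq y n) (seq z n))
      }
    ; *-comm = λ x y → pointwise (x * y) (y * x) λ n → ℚ.*-comm (seq x n) (seq y n)
    }
  }

module _ where
  open Determinant ℝ-commutativeRing
  open CommutativeRing ℝ-commutativeRing using (semiring; _-_)
  open RawSemiringOps (Semiring.rawSemiring semiring) using (product)

  -- The entries of μ are the eigenvalues of A, each listed as often as its
  -- algebraic multiplicity.  Equality of polynomials is equality of the
  -- functions they define, ℝ being infinite.
  Eigenvalues : ∀ {n} → Matrix ℝ n → Vector ℝ n → Set
  Eigenvalues A μ = ∀ t → charPoly A t ≈ product λ i → t - μ i

-- A complex with exactly n simplices, enumerated without repetition, whose
-- vertices are among the elements of Fin v (not every element of Fin v need
-- be a vertex).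
record SimplicialComplex (v n : ℕ) : Set where
  field
    simplex   : Fin n → Subset v
    injective : Injective _≡_ _≡_ simplex
    nonempty  : ∀ x → Nonempty (simplex x)
    closed    : ∀ x s → Nonempty s → s ⊆ simplex x → ∃[ y ] simplex y ≡ s

module _ {v n : ℕ} (G : SimplicialComplex v n) where
  open SimplicialComplex G
  open RawMonoidOps ℤ.+-0-rawMonoid using (sum)

  dim : Fin n → ℕ
  dim x = ∣ simplex x ∣ ∸ 1

  ω : Fin n → ℤ
  ω x = -1ℤ ℤ.^ dim x

  χ : Subset n → ℤ
  χ A = sum λ x → if lookup A x then ω x else 0ℤ

  C : Fin n → Subset n
  C x = tabulate λ y → does (simplex y ⊆? simplex x)

  connection : Matrix ℤ n
  connection x y = χ (C x ∩ C y)

  connectionMatrix : Matrix ℝ n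
  connectionMatrix x y = fromℤ (connection x y)

  degree : Fin n → ℕ
  degree x = ∣ tabulate (λ y → does (¬? (connection x y ℤ.≟ 0ℤ))) ∣

{-# OPTIONS --safe #-}
-- The entries of L are 0 or 1, since the non-empty subsets of x ∩ y have Euler
-- characteristic 0 or 1.  Hence d(x) is the row sum of L, and diag(d) − L is the
-- Laplacian Σ L(x,y) (f(x) − f(y))² / 2 ≥ 0.  By Weyl, λⱼ ≤ dⱼ: otherwise f ↦ fᵀ(L − dⱼ)f
-- would be positive on the span of j + 1 eigenvectors, yet it is at most 0 on the functions
-- vanishing at the j simplices of largest degree.
--
-- Rather than diagonalising L, a pencil s B − A with B positive definite is deflated: a zero
-- μ₀ of its determinant yields a kernel vector v, the pencil is congruent to a 1 × 1 block
-- and a smaller pencil on the B-orthogonal complement of v, and the factor s − μ₀ is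
-- cancelled from the determinant.  Each step uses up one eigenvalue above dⱼ and one linear
-- functional.  Everything takes place under a double negation, which is harmless because ≤
-- on ℝ is stable.
module Submission where

open import Defs using (Matrix; module Determinant)
open import Algebra.Bundles using (CommutativeRing; RawRing; Semiring)
import Algebra.Definitions.RawSemiring as RawSemiringOps
import Algebra.Properties.AbelianGroup as AbelianGroupProperties
import Algebra.Properties.CommutativeSemigroup as CommutativeSemigroupProperties
import Algebra.Properties.Ring as RingProperties
import Algebra.Properties.Semiring.Mult.TCOptimised as Mult
import Algebra.Properties.Semiring.Sum as SemiringSum
import Algebra.Solver.Ring as Solver
open import Algebra.Solver.Ring.AlmostCommutativeRing
  using (_-Raw-AlmostCommutative⟶_; fromCommutativeRing)
open import Data.Bool.Base using (true; false; if_then_else_; _∧_)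
import Data.Bool.Properties as Bool
open import Data.Empty using (⊥-elim)
open import Data.Fin.Base as Fin using (Fin; zero; suc; toℕ; punchIn; punchOut)
open import Data.Fin.Permutation using (_⟨$⟩ʳ_; _⟨$⟩ˡ_; inverseʳ)
import Data.Fin.Properties as Fin
open import Data.Fin.Subset as Subset using (Subset; inside; outside; _⊆_; _∩_; ∣_∣)
open import Data.Fin.Subset.Properties as Subset using (_⊆?_; nonempty?)
open import Data.Integer.Base as ℤ using (ℤ; 0ℤ; 1ℤ; -1ℤ)
import Data.Integer.Properties as ℤ
import Data.Integer.Solver as ℤ
open import Data.Maybe.Base using (Maybe; just; nothing)
open import Data.Nat.Base as ℕ using (ℕ; zero; suc)
import Data.Nat.Properties as ℕ
open import Data.Product.Base using (_×_; _,_; ∃-syntax)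
open import Data.Rational.Base as ℚ using (ℚ; 0ℚ; 1ℚ; ½)
import Data.Rational.Properties as ℚ
import Data.Rational.Solver as ℚ
import Data.Rational.Unnormalised.Base as ℚᵘ
import Data.Rational.Unnormalised.Properties as ℚᵘ
open import Data.Sum.Base using (_⊎_; inj₁; inj₂)
open import Data.Vec.Functional using (Vector; insertAt)
open import Data.Vec.Functional.Properties using (insertAt-lookup; insertAt-punchIn)
open import Data.Vec.Functional.Relation.Binary.Permutation using (_↭_)
open import Data.Vec.Properties using (≡-dec; lookup-zipWith; lookup∘tabulate)
open import Function.Base using (_∘_)
open import Level as Level using (0ℓ; _⊔_)
open import Relation.Binary.Definitions using (Antitonic₁)
open import Relation.Binary.PropositionalEquality as ≡ using (_≡_)
import Relation.Binary.Reasoning.Setoid as SetoidReasoning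
open import Relation.Nullary.Decidable using (Dec; yes; no; does; dec-true; dec-false; ¬?)
open import Relation.Nullary.Negation using (¬_; contradiction)

-- Equality and order of Cauchy reals cannot be decided, so no pivot can be searched for and no
-- eigenvector computed; the eigenvalues are known only as the factors of the characteristic
-- polynomial, itself given by its values. This accounts for the shape of the argument. The second
-- matrix `B` appears because a basis of the complement of `v` is left unnormalised:
-- orthonormalising would take divisions and square roots, whereas an unnormalised basis only
-- multiplies determinants by non-zero scalars. These are collected as `k` and `c` on the two sides
-- of the spectral identity. Multiplicities need no notion of eigenspace: each cancelled factor
-- `s - μ₀` removes one entry from the list. Since cancelling a factor of a function says nothing at
-- its zero, polynomials are recognised by finite differences. The vanishing conditions are
-- arbitrary linear functionals and not coordinates, because eliminating one of them along `v` does
-- not keep the others coordinates.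

-- Ring solving with integer coefficients

module IntegerSolver {c ℓ} (R : CommutativeRing c ℓ) where
  open CommutativeRing R
  open RingProperties ring
    using (x[y-z]≈xy-xz; [y-z]x≈yx-zx)
  open AbelianGroupProperties +-abelianGroup using (⁻¹-∙-comm; ⁻¹-involutive)
  open CommutativeSemigroupProperties +-commutativeSemigroup using (interchange)
  open Mult semiring renaming (_×_ to infixl 8 _·_) using (×-homo-+; ×1-homo-*)
  open SetoidReasoning setoid

  -- The pair (a , b) stands for the integer a − b.
  private
    Difference : RawRing _ _
    Difference = record
      { Carrier = ℕ × ℕ
      ; _≈_ = _≡_
      ; _+_ = λ (a , b) (c , d) → a ℕ.+ c , b ℕ.+ d
      ; _*_ = λ (a , b) (c , d) → a ℕ.* c ℕ.+ b ℕ.* d , a ℕ.* d ℕ.+ b ℕ.* c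
      ; -_  = λ (a , b) → b , a
      ; 0#  = 0 , 0
      ; 1#  = 1 , 0
      }

    value : RawRing.Carrier Difference → Carrier
    value (a , b) = a · 1# - b · 1#

    sum-of-differences : ∀ x y z w → (x + z) - (y + w) ≈ (x - y) + (z - w)
    sum-of-differences x y z w = begin
      (x + z) - (y + w)      ≈⟨ +-congˡ (⁻¹-∙-comm y w) ⟨
      (x + z) + (- y + - w)  ≈⟨ interchange x z (- y) (- w) ⟩
      (x - y) + (z - w)      ∎

    value-* : ∀ p q → value (RawRing._*_ Difference p q) ≈ value p * value q
    value-* (a , b) (c , d) = begin
      (a ℕ.* c ℕ.+ b ℕ.* d) · 1# - (a ℕ.* d ℕ.+ b ℕ.* c) · 1#
        ≈⟨ +-cong (expand a c b d) (-‿cong (expand a d b c)) ⟩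
      (x * z + y * w) - (x * w + y * z)
        ≈⟨ sum-of-differences _ _ _ _ ⟩
      (x * z - x * w) + (y * w - y * z)
        ≈⟨ +-congˡ (+-congʳ (⁻¹-involutive (y * w))) ⟨
      (x * z - x * w) + (- - (y * w) - y * z)
        ≈⟨ +-congˡ (trans (⁻¹-∙-comm _ _) (-‿cong (+-comm _ _))) ⟩
      (x * z - x * w) - (y * z - y * w)
        ≈⟨ +-cong (x[y-z]≈xy-xz x z w) (-‿cong (x[y-z]≈xy-xz y z w)) ⟨
      x * (z - w) - y * (z - w)
        ≈⟨ [y-z]x≈yx-zx (z - w) x y ⟨
      (x - y) * (z - w) ∎
      where
      x = a · 1#
      y = b · 1#
      z = c · 1#
      w = d · 1#
      expand : ∀ a c b d → (a ℕ.* c ℕ.+ b ℕ.* d) · 1# ≈ a · 1# * c · 1# + b · 1# * d · 1#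
      expand a c b d = trans (×-homo-+ 1# (a ℕ.* c) (b ℕ.* d))
                             (+-cong (×1-homo-* a c) (×1-homo-* b d))

    morphism : Difference -Raw-AlmostCommutative⟶ fromCommutativeRing R
    morphism = record
      { ⟦_⟧    = value
      ; +-homo = λ (a , b) (c , d) → trans
          (+-cong (×-homo-+ 1# a c) (-‿cong (×-homo-+ 1# b d))) (sum-of-differences _ _ _ _)
      ; *-homo = value-*
      ; -‿homo = λ (a , b) → sym (trans (sym (⁻¹-∙-comm _ _))
          (trans (+-comm _ _) (+-congʳ (⁻¹-involutive _))))
      ; 0-homo = -‿inverseʳ 0#
      ; 1-homo = trans (+-congˡ (trans (sym (+-identityˡ _)) (-‿inverseʳ 0#))) (+-identityʳ 1#)
      }

    -- Coefficients are unreduced pairs, so they are compared by cross addition: `(1 , 1)` and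
    -- `(0 , 0)` must count as equal for `x - x` to cancel.
    _≟_ : ∀ p q → Maybe (value p ≈ value q)
    (a , b) ≟ (c , d) with a ℕ.+ d ℕ.≟ c ℕ.+ b
    ... | no _ = nothing
    ... | yes ad≡cb = just (begin
      x - y              ≈⟨ +-identityʳ _ ⟨
      (x - y) + 0#       ≈⟨ +-congˡ (-‿inverseʳ w) ⟨
      (x - y) + (w - w)  ≈⟨ sum-of-differences x y w w ⟨
      (x + w) - (y + w)  ≈⟨ +-cong swap (-‿cong (+-comm y w)) ⟩
      (z + y) - (w + y)  ≈⟨ sum-of-differences z w y y ⟩
      (z - w) + (y - y)  ≈⟨ +-congˡ (-‿inverseʳ y) ⟩
      (z - w) + 0#       ≈⟨ +-identityʳ _ ⟩
      z - w              ∎)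
      where
      x = a · 1#
      y = b · 1#
      z = c · 1#
      w = d · 1#
      swap : x + w ≈ z + y
      swap = trans (sym (×-homo-+ 1# a d)) (trans (reflexive (≡.cong (_· 1#) ad≡cb)) (×-homo-+ 1# c b))

  open Solver Difference (fromCommutativeRing R) morphism _≟_ public

-- Determinants

module DeterminantTheory {c ℓ} (R : CommutativeRing c ℓ) where
  open CommutativeRing R hiding (zero)
  open Determinant R
  open IntegerSolver R using (solve; _:+_; _:*_; :-_; _:-_; _:=_)
  open SemiringSum semiring
  open RingProperties ring using (-0#≈0#; -1*x≈-x; +-cancelˡ)
  open RawSemiringOps (Semiring.rawSemiring semiring) using (_^_)
  open SetoidReasoning setoid
  open import Data.Vec.Functional using (_∷_)

  -- Linear and alternating forms on rows

  Row : ℕ → Set c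
  Row = Vector Carrier

  Form : ℕ → ℕ → Set c
  Form n m = (Fin n → Row m) → Carrier

  infix 4 _≋_
  _≋_ : ∀ {m} → Row m → Row m → Set ℓ
  x ≋ y = ∀ k → x k ≈ y k

  I : ∀ {n} → Matrix Carrier n
  I = scalar 1#

  record Linear {m} (f : Row m → Carrier) : Set (c ⊔ ℓ) where
    field
      cong : ∀ {x y} → x ≋ y → f x ≈ f y
      comb : ∀ x a y → f (λ k → x k + a * y k) ≈ f x + a * f y

    zero-homo : ∀ {x} → (∀ k → x k ≈ 0#) → f x ≈ 0#
    zero-homo {x} x≈0 = sym (+-cancelˡ (f x) 0# (f x) (begin
      f x + 0#       ≈⟨ +-identityʳ _ ⟩
      f x            ≈⟨ cong (λ k → trans (sym (trans (+-congˡ (trans (*-identityˡ _) (x≈0 k))) (+-identityʳ _))) refl) ⟩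
      f (λ k → x k + 1# * x k) ≈⟨ comb x 1# x ⟩
      f x + 1# * f x ≈⟨ +-congˡ (*-identityˡ _) ⟩
      f x + f x      ∎))

    scale : ∀ a y → f (λ k → a * y k) ≈ a * f y
    scale a y = begin
      f (λ k → a * y k)      ≈⟨ cong (λ k → sym (+-identityˡ _)) ⟩
      f (λ k → 0# + a * y k) ≈⟨ comb (λ _ → 0#) a y ⟩
      f (λ _ → 0#) + a * f y ≈⟨ +-congʳ (zero-homo (λ _ → refl)) ⟩
      0# + a * f y           ≈⟨ +-identityˡ _ ⟩
      a * f y                ∎

    add : ∀ x y → f (λ k → x k + y k) ≈ f x + f y
    add x y = trans (cong λ k → +-congˡ (sym (*-identityˡ _)))
                    (trans (comb x 1# y) (+-congˡ (*-identityˡ _)))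

    sum-homo : ∀ {n} (a : Vector Carrier n) (y : Fin n → Row m) →
               f (λ k → ∑[ j < n ] (a j * y j k)) ≈ ∑[ j < n ] (a j * f (y j))
    sum-homo {zero}  a y = zero-homo λ _ → refl
    sum-homo {suc n} a y = trans (add _ _) (+-cong (scale _ _) (sum-homo (a ∘ suc) (y ∘ suc)))

  record LinearMap {m n} (T : Row m → Row n) : Set (c ⊔ ℓ) where
    field
      cong : ∀ {x y} → x ≋ y → T x ≋ T y
      comb : ∀ x a y → T (λ k → x k + a * y k) ≋ λ l → T x l + a * T y l

  _∘-linear_ : ∀ {m n} {f : Row n → Carrier} {T : Row m → Row n} →
               Linear f → LinearMap T → Linear (f ∘ T)
  _∘-linear_ {T = T} f-lin T-lin = record
    { cong = λ x≋y → Linear.cong f-lin (LinearMap.cong T-lin x≋y)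
    ; comb = λ x a y → trans (Linear.cong f-lin (LinearMap.comb T-lin x a y))
                             (Linear.comb f-lin (T x) a (T y))
    }

  sum-zero : ∀ {n} (f : Vector Carrier n) → (∀ i → f i ≈ 0#) → sum f ≈ 0#
  sum-zero {n} f f≈0 = trans (sum-cong-≋ f≈0) (sum-replicate-zero n)

  sum-linear : ∀ {n m} (f : Fin n → Row m → Carrier) (a : Vector Carrier n) → (∀ j → Linear (f j)) →
               Linear (λ x → ∑[ j < n ] (a j * f j x))
  sum-linear {n} f a f-lin = record
    { cong = λ x≋y → sum-cong-≋ λ j → *-congˡ (Linear.cong (f-lin j) x≋y)
    ; comb = λ x b y → begin
        ∑[ j < n ] (a j * f j (λ k → x k + b * y k))
          ≈⟨ sum-cong-≋ (λ j → trans (*-congˡ (Linear.comb (f-lin j) x b y))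
               (solve 4 (λ a b p q → a :* (p :+ b :* q) := a :* p :+ b :* (a :* q)) refl _ _ _ _)) ⟩
        ∑[ j < n ] (a j * f j x + b * (a j * f j y))
          ≈⟨ ∑-distrib-+ (λ j → a j * f j x) _ ⟩
        ∑[ j < n ] (a j * f j x) + ∑[ j < n ] (b * (a j * f j y))
          ≈⟨ +-congˡ (*-distribˡ-sum b λ j → a j * f j y) ⟨
        ∑[ j < n ] (a j * f j x) + b * ∑[ j < n ] (a j * f j y) ∎
    }

  component-linear : ∀ {m} k → Linear {m} (λ x → x k)
  component-linear k = record { cong = λ x≋y → x≋y k ; comb = λ _ _ _ → refl }

  Congruent : ∀ {n m} → Form n m → Set (c ⊔ ℓ)
  Congruent D = ∀ {M N} → (∀ i → M i ≋ N i) → D M ≈ D N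

  -- Functions on `Fin` are not extensional, so a family of rows agrees with its head and tail only
  -- up to `≋`. This is why forms are required to be `Congruent`.
  η : ∀ {n m} (M : Fin (suc n) → Row m) i → M i ≋ (M zero ∷ M ∘ suc) i
  η M zero    k = refl
  η M (suc i) k = refl

  ∷-cong : ∀ {n m} {x y : Row m} {M N : Fin n → Row m} → x ≋ y → (∀ i → M i ≋ N i) →
           ∀ i → (x ∷ M) i ≋ (y ∷ N) i
  ∷-cong x≋y M≋N zero    = x≋y
  ∷-cong x≋y M≋N (suc i) = M≋N i

  ≋-refl : ∀ {m} {x : Row m} → x ≋ x
  ≋-refl k = refl

  -- Linearity and vanishing are required for the first row alone; later rows are covered by the
  -- form that remains once the first is fixed. A coincidence of two rows is recorded at the earlier
  -- one, so statements about all rows become structural inductions.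
  data Alternating {m} : ∀ {n} → Form n m → Set (c ⊔ ℓ) where
    nil  : {D : Form 0 m} → Congruent D → Alternating D
    cons : ∀ {n} {D : Form (suc n) m} → Congruent D →
           (∀ N → Linear λ x → D (x ∷ N)) →
           (∀ x → Alternating λ N → D (x ∷ N)) →
           (∀ {x} {N : Fin n → Row m} i → N i ≋ x → D (x ∷ N) ≈ 0#) →
           Alternating D

  congruent : ∀ {n m} {D : Form n m} → Alternating D → Congruent D
  congruent (nil c) = c
  congruent (cons c _ _ _) = c

  linear : ∀ {n m} {D : Form (suc n) m} → Alternating D → ∀ N → Linear λ x → D (x ∷ N)
  linear (cons _ l _ _) = l

  restrict : ∀ {n m} {D : Form (suc n) m} → Alternating D → ∀ x → Alternating λ N → D (x ∷ N)
  restrict (cons _ _ r _) = r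

  vanish : ∀ {n m} {D : Form (suc n) m} → Alternating D →
           ∀ {x} {N : Fin n → Row m} i → N i ≋ x → D (x ∷ N) ≈ 0#
  vanish (cons _ _ _ v) = v

  polarize : ∀ {m} (E : Row m → Row m → Carrier) →
             (∀ y → Linear λ x → E x y) → (∀ x → Linear (E x)) → (∀ x → E x x ≈ 0#) →
             ∀ x y → E x y ≈ - E y x
  polarize E linˡ linʳ E-diag x y = begin
    E x y                                         ≈⟨ solve 4 (λ a b p q → b := (p :+ b :+ (a :+ q)) :- p :- q :- a) refl (E y x) (E x y) (E x x) (E y y) ⟩
    (E x x + E x y + (E y x + E y y)) - E x x - E y y - E y x
      ≈⟨ +-congʳ (+-cong (+-cong sum≈0 (-‿cong (E-diag x))) (-‿cong (E-diag y))) ⟩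
    0# - 0# - 0# - E y x                          ≈⟨ +-congʳ (trans (+-congˡ -0#≈0#) (trans (+-identityʳ _) (-‿inverseʳ 0#))) ⟩
    0# - E y x                                    ≈⟨ +-identityˡ _ ⟩
    - E y x                                       ∎
    where
    x+y : Row _
    x+y k = x k + y k
    sum≈0 : E x x + E x y + (E y x + E y y) ≈ 0#
    sum≈0 = begin
      E x x + E x y + (E y x + E y y)  ≈⟨ +-cong (Linear.add (linʳ x) x y) (Linear.add (linʳ y) x y) ⟨
      E x x+y + E y x+y                ≈⟨ Linear.add (linˡ x+y) x y ⟨
      E x+y x+y                        ≈⟨ E-diag x+y ⟩
      0#                               ∎

  swap : ∀ {n m} {D : Form (suc (suc n)) m} → Alternating D → ∀ x y N →
         D (x ∷ y ∷ N) ≈ - D (y ∷ x ∷ N)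
  swap {D = D} alt x y N = polarize (λ x y → D (x ∷ y ∷ N))
    (λ y → linear alt (y ∷ N)) (λ x → linear (restrict alt x) N) (λ x → vanish alt zero ≋-refl) x y

  -- Only adjacent coincidences need to be checked: a later one is moved next to
  -- the first row by antisymmetry.
  vanish-from-adjacent : ∀ {n m} {D : Form (suc (suc n)) m} →
    (∀ N → Linear λ x → D (x ∷ N)) → (∀ x → Alternating λ N → D (x ∷ N)) →
    (∀ x N → D (x ∷ x ∷ N) ≈ 0#) →
    ∀ {x} {N : Fin (suc n) → Row m} i → N i ≋ x → D (x ∷ N) ≈ 0#
  vanish-from-adjacent {D = D} lin rest adj {x} {N} zero N₀≋x = begin
    D (x ∷ N)                      ≈⟨ congruent (rest x) (λ { zero → N₀≋x ; (suc i) → ≋-refl }) ⟩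
    D (x ∷ x ∷ N ∘ suc)            ≈⟨ adj x (N ∘ suc) ⟩
    0#                             ∎
  vanish-from-adjacent {D = D} lin rest adj {x} {N} (suc i) Nᵢ≋x = begin
    D (x ∷ N)                      ≈⟨ congruent (rest x) (η N) ⟩
    D (x ∷ N zero ∷ N ∘ suc)       ≈⟨ polarize (λ x y → D (x ∷ y ∷ N ∘ suc)) (λ y → lin _)
                                        (λ x → linear (rest x) _) (λ x → adj x _) x (N zero) ⟩
    - D (N zero ∷ x ∷ N ∘ suc)     ≈⟨ -‿cong (vanish (rest (N zero)) i Nᵢ≋x) ⟩
    - 0#                           ≈⟨ -0#≈0# ⟩
    0#                             ∎

  alternating-pullback : ∀ {n m m′} {D : Form n m′} {T : Row m → Row m′} → LinearMap T →
                         Alternating D → Alternating (λ N → D (T ∘ N))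
  alternating-pullback T-lin (nil c) = nil λ M≋N → c (λ i → LinearMap.cong T-lin (M≋N i))
  alternating-pullback {D = D} {T} T-lin (cons D-cong lin rest van) = cons
    (λ M≋N → D-cong λ i → LinearMap.cong T-lin (M≋N i))
    (λ N → record
      { cong = λ x≋y → D-cong λ { zero → LinearMap.cong T-lin x≋y ; (suc i) → ≋-refl }
      ; comb = λ x a y → trans (push _ N) (trans
          (Linear.cong (lin (T ∘ N)) (LinearMap.comb T-lin x a y))
          (trans (Linear.comb (lin (T ∘ N)) (T x) a (T y))
                 (+-cong (sym (push x N)) (*-congˡ (sym (push y N))))))
      })
    (λ x → alternating-cong (λ N → sym (push x N)) (alternating-pullback T-lin (rest (T x))))
    (λ {x} {N} i Nᵢ≋x → trans (push x N) (van i (LinearMap.cong T-lin Nᵢ≋x)))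
    where
    push : ∀ x N → D (T ∘ (x ∷ N)) ≈ D (T x ∷ T ∘ N)
    push x N = D-cong (η (T ∘ (x ∷ N)))
    alternating-cong : ∀ {n m} {D E : Form n m} → (∀ N → D N ≈ E N) → Alternating D → Alternating E
    alternating-cong D≈E (nil c) = nil λ M≋N → trans (sym (D≈E _)) (trans (c M≋N) (D≈E _))
    alternating-cong D≈E (cons c lin rest van) = cons
      (λ M≋N → trans (sym (D≈E _)) (trans (c M≋N) (D≈E _)))
      (λ N → record
        { cong = λ x≋y → trans (sym (D≈E _)) (trans (Linear.cong (lin N) x≋y) (D≈E _))
        ; comb = λ x a y → trans (sym (D≈E _)) (trans (Linear.comb (lin N) x a y)
                                  (+-cong (D≈E _) (*-congˡ (D≈E _)))) })
      (λ x → alternating-cong (λ N → D≈E (x ∷ N)) (rest x))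
      (λ i Nᵢ≋x → trans (sym (D≈E _)) (van i Nᵢ≋x))

  alternating-sum : ∀ {n m p} (a : Vector Carrier p) {D : Fin p → Form n m} →
                    (∀ j → Alternating (D j)) → Alternating (λ N → ∑[ j < p ] (a j * D j N))
  alternating-sum {zero} a alt = nil λ M≋N → sum-cong-≋ λ j → *-congˡ (congruent (alt j) M≋N)
  alternating-sum {suc n} a alt = cons
    (λ M≋N → sum-cong-≋ λ j → *-congˡ (congruent (alt j) M≋N))
    (λ N → sum-linear _ a λ j → linear (alt j) N)
    (λ x → alternating-sum a λ j → restrict (alt j) x)
    (λ i Nᵢ≋x → sum-zero _ λ j → trans (*-congˡ (vanish (alt j) i Nᵢ≋x)) (zeroʳ _))

  -- The determinant as an alternating form

  sign : ∀ {n} → Fin n → Carrier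
  sign j = (- 1#) ^ toℕ j

  removeColumn : ∀ {m} → Fin (suc m) → Row (suc m) → Row m
  removeColumn j x = x ∘ punchIn j

  removeColumn-linear : ∀ {m} (j : Fin (suc m)) → LinearMap (removeColumn j)
  removeColumn-linear j = record { cong = λ x≋y k → x≋y _ ; comb = λ _ _ _ _ → refl }

  -- Deleting column j and then column k of the remaining ones deletes the same
  -- pair of columns as partner j k, which lists them in the other order.
  partner : ∀ {n} → Fin (suc n) → Fin n → Fin (suc n) × Fin n
  partner {suc n} zero    k       = suc k , zero
  partner {suc n} (suc j) zero    = zero , j
  partner {suc n} (suc j) (suc k) = let j′ , k′ = partner j k in suc j′ , suc k′

  -- Summing the pairs twice would only show that twice the sum vanishes. Instead `g zero k` is
  -- cancelled against `g (suc k) zero`, and the remaining pairs form a smaller instance, since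
  -- `partner` commutes with `suc` on them.
  sum-partner : ∀ {n} (g : Fin (suc n) → Fin n → Carrier) →
                (∀ j k → let j′ , k′ = partner j k in g j k + g j′ k′ ≈ 0#) →
                ∑[ j < suc n ] ∑[ k < n ] g j k ≈ 0#
  sum-partner {zero}  g h = sum-zero {1} _ λ _ → refl
  sum-partner {suc n} g h = begin
    sum (g zero) + ∑[ j < suc n ] (g (suc j) zero + ∑[ k < n ] g (suc j) (suc k))
      ≈⟨ +-congˡ (∑-distrib-+ (λ j → g (suc j) zero) λ j → ∑[ k < n ] g (suc j) (suc k)) ⟩
    sum (g zero) + (∑[ j < suc n ] g (suc j) zero + ∑[ j < suc n ] ∑[ k < n ] g (suc j) (suc k))
      ≈⟨ +-assoc _ _ _ ⟨
    sum (g zero) + ∑[ j < suc n ] g (suc j) zero + ∑[ j < suc n ] ∑[ k < n ] g (suc j) (suc k)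
      ≈⟨ +-congʳ (∑-distrib-+ (g zero) λ j → g (suc j) zero) ⟨
    ∑[ k < suc n ] (g zero k + g (suc k) zero) + ∑[ j < suc n ] ∑[ k < n ] g (suc j) (suc k)
      ≈⟨ +-cong (sum-zero _ (h zero)) (sum-partner (λ j k → g (suc j) (suc k)) λ j k → h (suc j) (suc k)) ⟩
    0# + 0#
      ≈⟨ +-identityˡ _ ⟩
    0# ∎

  partner-punchIn : ∀ {n} (j : Fin (suc n)) k → let j′ , k′ = partner j k in
                    j′ ≡ punchIn j k × punchIn j′ k′ ≡ j
  partner-punchIn {suc n} zero k = ≡.refl , ≡.refl
  partner-punchIn {suc n} (suc j) zero = ≡.refl , ≡.refl
  partner-punchIn {suc n} (suc j) (suc k) = let p , q = partner-punchIn j k in ≡.cong suc p , ≡.cong suc q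

  partner-minor : ∀ {n} (j : Fin (suc (suc n))) k i → let j′ , k′ = partner j k in
                  punchIn j (punchIn k i) ≡ punchIn j′ (punchIn k′ i)
  partner-minor zero k i = ≡.refl
  partner-minor {suc n} (suc j) zero i       = ≡.refl
  partner-minor {suc n} (suc j) (suc k) zero = ≡.refl
  partner-minor {suc n} (suc j) (suc k) (suc i) = ≡.cong suc (partner-minor j k i)

  -- Deleting the smaller column first lowers the index of the larger one, so the two exponents
  -- differ by one.
  partner-sign : ∀ {n} (j : Fin (suc n)) k → let j′ , k′ = partner j k in
                 sign j * sign k + sign j′ * sign k′ ≈ 0#
  partner-sign {suc n} zero k = begin
    1# * sign k + - 1# * sign k * 1#   ≈⟨ solve 2 (λ o e → o :* e :+ :- o :* e :* o := o :* e :- (o :* e) :* o) refl 1# (sign k) ⟩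
    1# * sign k - 1# * sign k * 1#     ≈⟨ +-congˡ (-‿cong (*-identityʳ _)) ⟩
    1# * sign k - 1# * sign k          ≈⟨ -‿inverseʳ _ ⟩
    0#                           ∎
  partner-sign {suc n} (suc j) zero = begin
    - 1# * sign j * 1# + 1# * sign j   ≈⟨ solve 2 (λ o e → :- o :* e :* o :+ o :* e := o :* e :- (o :* e) :* o) refl 1# (sign j) ⟩
    1# * sign j - 1# * sign j * 1#     ≈⟨ +-congˡ (-‿cong (*-identityʳ _)) ⟩
    1# * sign j - 1# * sign j          ≈⟨ -‿inverseʳ _ ⟩
    0#                           ∎
  partner-sign {suc n} (suc j) (suc k) = let j′ , k′ = partner j k in begin
    - 1# * sign j * (- 1# * sign k) + - 1# * sign j′ * (- 1# * sign k′)
      ≈⟨ solve 5 (λ o a b c d → :- o :* a :* (:- o :* b) :+ :- o :* c :* (:- o :* d)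
                    := o :* o :* (a :* b :+ c :* d)) refl 1# (sign j) (sign k) (sign j′) (sign k′) ⟩
    1# * 1# * (sign j * sign k + sign j′ * sign k′)
      ≈⟨ *-congˡ (partner-sign j k) ⟩
    1# * 1# * 0#
      ≈⟨ zeroʳ _ ⟩
    0# ∎

  det-cong : ∀ {n} → Congruent (det {n})
  det-cong {zero}  M≋N = refl
  det-cong {suc n} M≋N = sum-cong-≋ λ j →
    *-cong (*-congˡ {sign j} (M≋N zero j)) (det-cong λ i k → M≋N (suc i) (punchIn j k))

  -- When both equal rows are expanded, the terms of `j , k` and of its partner share the minor and
  -- the product of entries, with opposite signs.
  det-adjacent : ∀ {n} x (N : Fin n → Row (suc (suc n))) → det (x ∷ x ∷ N) ≈ 0#
  det-adjacent {n} x N = begin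
    ∑[ j < suc (suc n) ] (sign j * x j * ∑[ k < suc n ] (sign k * x (punchIn j k) * minor j k))
      ≈⟨ sum-cong-≋ (λ j → *-distribˡ-sum (sign j * x j) λ k → sign k * x (punchIn j k) * minor j k) ⟩
    ∑[ j < suc (suc n) ] ∑[ k < suc n ] term j k
      ≈⟨ sum-partner term pair ⟩
    0# ∎
    where
    minor : Fin (suc (suc n)) → Fin (suc n) → Carrier
    minor j k = det λ i l → N i (punchIn j (punchIn k l))
    term : Fin (suc (suc n)) → Fin (suc n) → Carrier
    term j k = sign j * x j * (sign k * x (punchIn j k) * minor j k)
    pair : ∀ j k → let j′ , k′ = partner j k in term j k + term j′ k′ ≈ 0#
    pair j k = let j′ , k′ = partner j k ; p , q = partner-punchIn j k in begin
      sign j * x j * (sign k * x (punchIn j k) * minor j k) + term j′ k′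
        ≈⟨ +-cong (*-congˡ (*-congʳ (*-congˡ (reflexive (≡.cong x (≡.sym p))))))
                  (*-congˡ (*-cong (*-congˡ (reflexive (≡.cong x q)))
                     (det-cong λ i l → reflexive (≡.cong (N i) (≡.sym (partner-minor j k l)))))) ⟩
      sign j * x j * (sign k * x j′ * minor j k) + sign j′ * x j′ * (sign k′ * x j * minor j k)
        ≈⟨ solve 7 (λ a b c d x y m → a :* x :* (b :* y :* m) :+ c :* y :* (d :* x :* m)
              := (a :* b :+ c :* d) :* (x :* y :* m)) refl (sign j) (sign k) (sign j′) (sign k′) (x j) (x j′) (minor j k) ⟩
      (sign j * sign k + sign j′ * sign k′) * (x j * x j′ * minor j k)
        ≈⟨ *-congʳ (partner-sign j k) ⟩
      0# * (x j * x j′ * minor j k)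
        ≈⟨ zeroˡ _ ⟩
      0# ∎

  det-linear : ∀ {n} (N : Fin n → Row (suc n)) → Linear λ x → det (x ∷ N)
  det-linear {n} N = record
    { cong = λ x≋y → sum-cong-≋ λ j → *-congʳ {minor j} (*-congˡ {sign j} (x≋y j))
    ; comb = λ x a y → begin
        ∑[ j < suc n ] (sign j * (x j + a * y j) * minor j)
          ≈⟨ sum-cong-≋ (λ j → solve 5 (λ e x a y d → e :* (x :+ a :* y) :* d
               := e :* x :* d :+ a :* (e :* y :* d)) refl (sign j) (x j) a (y j) (minor j)) ⟩
        ∑[ j < suc n ] (sign j * x j * minor j + a * (sign j * y j * minor j))
          ≈⟨ ∑-distrib-+ (λ j → sign j * x j * minor j) (λ j → a * (sign j * y j * minor j)) ⟩
        ∑[ j < suc n ] (sign j * x j * minor j) + ∑[ j < suc n ] (a * (sign j * y j * minor j))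
          ≈⟨ +-congˡ (*-distribˡ-sum a λ j → sign j * y j * minor j) ⟨
        ∑[ j < suc n ] (sign j * x j * minor j) + a * ∑[ j < suc n ] (sign j * y j * minor j) ∎
    }
    where
    minor : Fin (suc n) → Carrier
    minor j = det λ i k → N i (punchIn j k)

  det-alternating : ∀ {n} → Alternating (det {n})
  det-alternating {zero}  = nil λ _ → refl
  det-alternating {suc n} = cons det-cong det-linear (det-restrict n) (det-vanish n)
    where
    det-restrict : ∀ n (x : Row (suc n)) → Alternating {n = n} λ N → det (x ∷ N)
    det-restrict n x = alternating-sum (λ j → sign j * x j) λ j →
      alternating-pullback (removeColumn-linear j) det-alternating
    det-vanish : ∀ n {x} {N : Fin n → Row (suc n)} i → N i ≋ x → det (x ∷ N) ≈ 0#
    det-vanish (suc n) = vanish-from-adjacent {D = det} det-linear (det-restrict (suc n)) det-adjacent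

  -- Uniqueness of alternating forms and the product formula

  I-same : ∀ {n} (j : Fin n) → I j j ≈ 1#
  I-same zero    = refl
  I-same (suc j) = I-same j

  I-punchIn : ∀ {n} (j : Fin (suc n)) k → I j (punchIn j k) ≈ 0#
  I-punchIn zero    k       = refl
  I-punchIn (suc j) zero    = refl
  I-punchIn (suc j) (suc k) = I-punchIn j k

  I-punchIn² : ∀ {n} (j : Fin (suc n)) i k → I (punchIn j i) (punchIn j k) ≈ I i k
  I-punchIn² zero    i       k       = refl
  I-punchIn² (suc j) zero    zero    = refl
  I-punchIn² (suc j) zero    (suc k) = refl
  I-punchIn² (suc j) (suc i) zero    = refl
  I-punchIn² (suc j) (suc i) (suc k) = I-punchIn² j i k

  I-sym : ∀ {n} (i k : Fin n) → I i k ≈ I k i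
  I-sym zero    zero    = refl
  I-sym zero    (suc k) = refl
  I-sym (suc i) zero    = refl
  I-sym (suc i) (suc k) = I-sym i k

  data View {n} (j : Fin (suc n)) : Fin (suc n) → Set where
    same  : View j j
    other : ∀ k → View j (punchIn j k)

  view : ∀ {n} (j k : Fin (suc n)) → View j k
  view j k with j Fin.≟ k
  ... | yes ≡.refl = same
  ... | no j≢k     = ≡.subst (View j) (Fin.punchIn-punchOut j≢k) (other (punchOut j≢k))

  sum-pick : ∀ {n} (x : Row n) k → ∑[ j < n ] (x j * I j k) ≈ x k
  sum-pick {suc n} x k = begin
    ∑[ j < suc n ] (x j * I j k)
      ≈⟨ sum-remove {i = k} (λ j → x j * I j k) ⟩
    x k * I k k + ∑[ j < n ] (x (punchIn k j) * I (punchIn k j) k)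
      ≈⟨ +-cong (trans (*-congˡ (I-same k)) (*-identityʳ _))
                (sum-zero _ λ j → trans (*-congˡ (trans (I-sym _ k) (I-punchIn k j))) (zeroʳ _)) ⟩
    x k + 0#
      ≈⟨ +-identityʳ _ ⟩
    x k ∎

  linear-expand : ∀ {m} {f : Row m → Carrier} → Linear f → ∀ x → f x ≈ ∑[ j < m ] (x j * f (I j))
  linear-expand f-lin x = trans (Linear.cong f-lin λ k → sym (sum-pick x k)) (Linear.sum-homo f-lin x I)

  -- Linearity in each row leaves an extra term with `e` as that row, which `van` kills. In
  -- `det-unique`, `e` is a first row already split off and the added multiples clear a column.
  shear : ∀ {n m} {D : Form n m} → Alternating D → ∀ e →
          (∀ {N} i → N i ≋ e → D N ≈ 0#) →
          ∀ (a : Vector Carrier n) N → D (λ i k → N i k + a i * e k) ≈ D N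
  shear {zero}  alt e van a N = congruent alt λ ()
  shear {suc n} {D = D} alt e van a N = begin
    D (λ i k → N i k + a i * e k)
      ≈⟨ congruent alt (η _) ⟩
    D ((λ k → N zero k + a zero * e k) ∷ N′)
      ≈⟨ Linear.comb (linear alt N′) (N zero) (a zero) e ⟩
    D (N zero ∷ N′) + a zero * D (e ∷ N′)
      ≈⟨ +-cong (shear (restrict alt (N zero)) e (λ i Nᵢ≋e → van (suc i) Nᵢ≋e) (a ∘ suc) (N ∘ suc))
                (trans (*-congˡ (van zero ≋-refl)) (zeroʳ _)) ⟩
    D (N zero ∷ N ∘ suc) + 0#
      ≈⟨ +-identityʳ _ ⟩
    D (N zero ∷ N ∘ suc)
      ≈⟨ congruent alt (η N) ⟨
    D N ∎
    where
    N′ : Fin n → Row _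
    N′ i k = N (suc i) k + a (suc i) * e k

  -- The row `x j` passes the rows before it one at a time, each exchange contributing `- 1#`.
  cycle : ∀ {n m} {D : Form (suc n) m} → Alternating D → ∀ x j →
          D (x j ∷ x ∘ punchIn j) ≈ sign j * D x
  cycle alt x zero = trans (sym (congruent alt (η x))) (sym (*-identityˡ _))
  cycle {suc n} {D = D} alt x (suc j) = begin
    D (x (suc j) ∷ x ∘ punchIn (suc j))
      ≈⟨ congruent alt (∷-cong ≋-refl (η _)) ⟩
    D (x (suc j) ∷ x zero ∷ x ∘ suc ∘ punchIn j)
      ≈⟨ swap alt _ _ _ ⟩
    - D (x zero ∷ x (suc j) ∷ x ∘ suc ∘ punchIn j)
      ≈⟨ -‿cong (cycle (restrict alt (x zero)) (x ∘ suc) j) ⟩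
    - (sign j * D (x zero ∷ x ∘ suc))
      ≈⟨ -‿cong (*-congˡ (congruent alt (η x))) ⟨
    - (sign j * D x)
      ≈⟨ -1*x≈-x _ ⟨
    - 1# * (sign j * D x)
      ≈⟨ *-assoc _ _ _ ⟨
    sign (suc j) * D x ∎

  -- Embeds the rows of a minor, so that a form in rows of length `suc n` pulls back to one of
  -- length `n`, where the induction of `det-unique` applies.
  insertZero : ∀ {n} → Fin (suc n) → Row n → Row (suc n)
  insertZero j x = insertAt x j 0#

  insertZero-linear : ∀ {n} (j : Fin (suc n)) → LinearMap (insertZero {n} j)
  insertZero-linear j = record { cong = λ x≋y k → insert-cong x≋y (view j k) ; comb = λ x a y k → insert-comb x a y (view j k) }
    where
    insert-cong : ∀ {x y k} → x ≋ y → View j k → insertZero j x k ≈ insertZero j y k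
    insert-cong {x} {y} x≋y same = reflexive (≡.trans (insertAt-lookup x j 0#) (≡.sym (insertAt-lookup y j 0#)))
    insert-cong {x} {y} x≋y (other k) = begin
      insertZero j x (punchIn j k)  ≡⟨ insertAt-punchIn x j 0# k ⟩
      x k                           ≈⟨ x≋y k ⟩
      y k                           ≡⟨ insertAt-punchIn y j 0# k ⟨
      insertZero j y (punchIn j k)  ∎
    insert-comb : ∀ x a y {k} → View j k →
                  insertZero j (λ k → x k + a * y k) k ≈ insertZero j x k + a * insertZero j y k
    insert-comb x a y same = begin
      insertZero j (λ k → x k + a * y k) j       ≡⟨ insertAt-lookup _ j 0# ⟩
      0#                                         ≈⟨ trans (+-congˡ (zeroʳ a)) (+-identityʳ _) ⟨
      0# + a * 0#                                ≡⟨ ≡.cong₂ (λ u v → u + a * v) (insertAt-lookup x j 0#) (insertAt-lookup y j 0#) ⟨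
      insertZero j x j + a * insertZero j y j    ∎
    insert-comb x a y (other k) = reflexive (≡.trans (insertAt-punchIn _ j 0# k)
      (≡.sym (≡.cong₂ (λ u v → u + a * v) (insertAt-punchIn x j 0# k) (insertAt-punchIn y j 0# k))))

  -- Expanding the first row reduces to a first row I j; subtracting multiples of
  -- it clears column j, leaving an alternating form in the minor.
  det-unique : ∀ {n} {D : Form n n} → Alternating D → ∀ M → D M ≈ det M * D I
  det-unique {zero}  alt M = trans (congruent alt λ ()) (sym (*-identityˡ _))
  det-unique {suc n} {D} alt M = begin
    D M
      ≈⟨ congruent alt (η M) ⟩
    D (M zero ∷ M ∘ suc)
      ≈⟨ linear-expand (linear alt (M ∘ suc)) (M zero) ⟩
    ∑[ j < suc n ] (M zero j * D (I j ∷ M ∘ suc))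
      ≈⟨ sum-cong-≋ step ⟩
    ∑[ j < suc n ] (sign j * M zero j * minor j * D I)
      ≈⟨ *-distribʳ-sum (D I) (λ j → sign j * M zero j * minor j) ⟨
    det M * D I ∎
    where
    minor : Fin (suc n) → Carrier
    minor j = det λ i k → M (suc i) (punchIn j k)
    cleared : ∀ j i {k} → View j k → M (suc i) k + - M (suc i) j * I j k ≈ insertZero j (M (suc i) ∘ punchIn j) k
    cleared j i same = begin
      M (suc i) j + - M (suc i) j * I j j  ≈⟨ +-congˡ (trans (*-congˡ (I-same j)) (*-identityʳ _)) ⟩
      M (suc i) j - M (suc i) j            ≈⟨ -‿inverseʳ _ ⟩
      0#                                   ≡⟨ insertAt-lookup _ j 0# ⟨
      insertZero j (M (suc i) ∘ punchIn j) j ∎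
    cleared j i (other k) = begin
      M (suc i) (punchIn j k) + - M (suc i) j * I j (punchIn j k)  ≈⟨ +-congˡ (trans (*-congˡ (I-punchIn j k)) (zeroʳ _)) ⟩
      M (suc i) (punchIn j k) + 0#                                 ≈⟨ +-identityʳ _ ⟩
      M (suc i) (punchIn j k)                                      ≡⟨ insertAt-punchIn _ j 0# k ⟨
      insertZero j (M (suc i) ∘ punchIn j) (punchIn j k)           ∎
    basis : ∀ j i {k} → View j k → insertZero j (I i) k ≈ I (punchIn j i) k
    basis j i same = trans (reflexive (insertAt-lookup _ j 0#)) (sym (trans (I-sym _ j) (I-punchIn j i)))
    basis j i (other k) = trans (reflexive (insertAt-punchIn _ j 0# k)) (sym (I-punchIn² j i k))
    step : ∀ j → M zero j * D (I j ∷ M ∘ suc) ≈ sign j * M zero j * minor j * D I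
    step j = begin
      M zero j * D (I j ∷ M ∘ suc)
        ≈⟨ *-congˡ (shear (restrict alt (I j)) (I j) (vanish alt) (λ i → - M (suc i) j) (M ∘ suc)) ⟨
      M zero j * D (I j ∷ λ i k → M (suc i) k + - M (suc i) j * I j k)
        ≈⟨ *-congˡ (congruent alt (∷-cong ≋-refl λ i k → cleared j i (view j k))) ⟩
      M zero j * D (I j ∷ λ i → insertZero j (M (suc i) ∘ punchIn j))
        ≈⟨ *-congˡ (det-unique (alternating-pullback (insertZero-linear j) (restrict alt (I j))) _) ⟩
      M zero j * (minor j * D (I j ∷ insertZero j ∘ I))
        ≈⟨ *-congˡ (*-congˡ (trans (congruent alt (∷-cong ≋-refl λ i k → basis j i (view j k))) (cycle alt I j))) ⟩
      M zero j * (minor j * (sign j * D I))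
        ≈⟨ solve 4 (λ m d e i → m :* (d :* (e :* i)) := e :* m :* d :* i) refl (M zero j) (minor j) (sign j) (D I) ⟩
      sign j * M zero j * minor j * D I ∎

  infixl 7 _·_
  _·_ : ∀ {l m n} → (Fin l → Row m) → (Fin m → Row n) → Fin l → Row n
  (_·_ {m = m} M N) i k = ∑[ j < m ] (M i j * N j k)

  rowTimes-linear : ∀ {m n} (N : Fin m → Row n) → LinearMap (λ x k → ∑[ j < m ] (x j * N j k))
  rowTimes-linear {m} N = record
    { cong = λ x≋y k → sum-cong-≋ λ j → *-congʳ (x≋y j)
    ; comb = λ x a y k → begin
        ∑[ j < m ] ((x j + a * y j) * N j k)
          ≈⟨ sum-cong-≋ (λ j → solve 4 (λ x a y n → (x :+ a :* y) :* n := x :* n :+ a :* (y :* n)) refl (x j) a (y j) (N j k)) ⟩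
        ∑[ j < m ] (x j * N j k + a * (y j * N j k))
          ≈⟨ ∑-distrib-+ (λ j → x j * N j k) (λ j → a * (y j * N j k)) ⟩
        ∑[ j < m ] (x j * N j k) + ∑[ j < m ] (a * (y j * N j k))
          ≈⟨ +-congˡ (*-distribˡ-sum a λ j → y j * N j k) ⟨
        ∑[ j < m ] (x j * N j k) + a * ∑[ j < m ] (y j * N j k) ∎
    }

  -- Both sides are alternating in the rows of `M`, so by uniqueness they need only be compared at
  -- `I`.
  det-· : ∀ {n} (M N : Matrix Carrier n) → det (M · N) ≈ det M * det N
  det-· {n} M N = trans (det-unique (alternating-pullback (rowTimes-linear N) det-alternating) M)
    (*-congˡ (det-cong λ i k → trans (sum-cong-≋ {n} λ j → trans (*-congʳ (I-sym i j)) (*-comm _ _)) (sum-pick (λ j → N j k) i)))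

  det-block : ∀ {n} (M : Matrix Carrier (suc n)) → (∀ k → M zero (suc k) ≈ 0#) →
              det M ≈ M zero zero * det (λ i k → M (suc i) (suc k))
  det-block {n} M M₀≈0 = begin
    1# * M zero zero * minor zero + ∑[ j < n ] (sign (suc j) * M zero (suc j) * minor (suc j))
      ≈⟨ +-cong (*-congʳ (*-identityˡ _)) (sum-zero _ λ j →
           trans (*-congʳ (trans (*-congˡ (M₀≈0 j)) (zeroʳ _))) (zeroˡ _)) ⟩
    M zero zero * minor zero + 0#
      ≈⟨ +-identityʳ _ ⟩
    M zero zero * minor zero ∎
    where
    minor : Fin (suc n) → Carrier
    minor j = det λ i k → M (suc i) (punchIn j k)

-- Ordered domains

-- These axioms hold for Cauchy reals without any decision: in place of trichotomy, `connex` infers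
-- equality with zero from two refutations.
record IsOrderedDomain {c ℓ} p (R : CommutativeRing c ℓ) : Set (c ⊔ ℓ ⊔ Level.suc p) where
  open CommutativeRing R
  field
    Positive : Carrier → Set p
    positive-resp : ∀ {x y} → x ≈ y → Positive x → Positive y
    positive-+ : ∀ {x y} → Positive x → Positive y → Positive (x + y)
    positive-* : ∀ {x y} → Positive x → Positive y → Positive (x * y)
    positive-1 : Positive 1#
    ¬positive-0 : ¬ Positive 0#
    connex : ∀ {x} → ¬ Positive x → ¬ Positive (- x) → x ≈ 0#

module OrderedDomain {c ℓ p} (R : CommutativeRing c ℓ) (isOrderedDomain : IsOrderedDomain p R) where
  open CommutativeRing R hiding (zero)
  open Determinant R
  open IntegerSolver R using (solve; _:+_; _:*_; :-_; _:-_; _:=_)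
  open SemiringSum semiring
  open RingProperties ring using (-‿distribˡ-*; -0#≈0#; -1*x≈-x)
  open RawSemiringOps (Semiring.rawSemiring semiring) using (product)
  open SetoidReasoning setoid
  open DeterminantTheory R
  open IsOrderedDomain isOrderedDomain
  open import Data.Vec.Functional using (_∷_)

  -- The premises of `connex` are negations, and a doubly negated equation suffices to supply them.
  -- A proof of an equation may therefore suppose its negation.
  stable : ∀ {x} → ¬ ¬ (x ≈ 0#) → x ≈ 0#
  stable h = connex
    (λ x>0 → h λ x≈0 → ¬positive-0 (positive-resp x≈0 x>0))
    (λ -x>0 → h λ x≈0 → ¬positive-0 (positive-resp (trans (-‿cong x≈0) -0#≈0#) -x>0))

  ¬opposite : ∀ {x y} → x + y ≈ 0# → Positive x → ¬ Positive y
  ¬opposite x+y≈0 x>0 y>0 = ¬positive-0 (positive-resp x+y≈0 (positive-+ x>0 y>0))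

  -- Neither an inverse nor a sign of `x` is at hand. A sign of `y` would refute both signs of `x`
  -- and so make `x` zero.
  no-zero-divisors : ∀ {x y} → x * y ≈ 0# → ¬ x ≈ 0# → y ≈ 0#
  no-zero-divisors {x} {y} xy≈0 x≉0 = connex
    (λ y>0 → x≉0 (connex
      (λ x>0 → absurd (positive-* x>0 y>0) xy≈0)
      (λ -x>0 → absurd (positive-* -x>0 y>0)
        (trans (solve 2 (λ x y → :- x :* y := :- (x :* y)) refl x y) -xy≈0))))
    (λ -y>0 → x≉0 (connex
      (λ x>0 → absurd (positive-* x>0 -y>0)
        (trans (solve 2 (λ x y → x :* :- y := :- (x :* y)) refl x y) -xy≈0))
      (λ -x>0 → absurd (positive-* -x>0 -y>0)
        (trans (solve 2 (λ x y → :- x :* :- y := x :* y) refl x y) xy≈0))))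
    where
    absurd : ∀ {z} → Positive z → ¬ z ≈ 0#
    absurd z>0 z≈0 = ¬positive-0 (positive-resp z≈0 z>0)
    -xy≈0 : - (x * y) ≈ 0#
    -xy≈0 = trans (-‿cong xy≈0) -0#≈0#

  *-nonzero : ∀ {x y} → ¬ x ≈ 0# → ¬ y ≈ 0# → ¬ x * y ≈ 0#
  *-nonzero x≉0 y≉0 xy≈0 = y≉0 (no-zero-divisors xy≈0 x≉0)

  positive⇒nonzero : ∀ {x} → Positive x → ¬ x ≈ 0#
  positive⇒nonzero x>0 x≈0 = ¬positive-0 (positive-resp x≈0 x>0)

  Nonneg : Carrier → Set p
  Nonneg x = ¬ Positive (- x)

  nonneg-resp : ∀ {x y} → x ≈ y → Nonneg x → Nonneg y
  nonneg-resp x≈y x≥0 -y>0 = x≥0 (positive-resp (-‿cong (sym x≈y)) -y>0)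

  nonneg-0 : Nonneg 0#
  nonneg-0 -0>0 = ¬positive-0 (positive-resp -0#≈0# -0>0)

  positive⇒nonneg : ∀ {x} → Positive x → Nonneg x
  positive⇒nonneg x>0 = ¬opposite (-‿inverseʳ _) x>0

  -- If `- (x + y)` were positive, a positive `x` would make `- y` positive. Hence `x` is zero by
  -- `connex`, and then `- y` is positive after all.
  nonneg-+ : ∀ {x y} → Nonneg x → Nonneg y → Nonneg (x + y)
  nonneg-+ {x} {y} x≥0 y≥0 -x-y>0 = y≥0 (positive-resp
      (trans (solve 2 (λ x y → :- (x :+ y) := :- x :- y) refl x y)
             (trans (+-congʳ (trans (-‿cong x≈0) -0#≈0#)) (+-identityˡ _))) -x-y>0)
    where
    x≈0 : x ≈ 0#
    x≈0 = connex (λ x>0 → y≥0 (positive-resp (solve 2 (λ x y → x :- (x :+ y) := :- y) refl x y)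
                                (positive-+ x>0 -x-y>0))) x≥0

  nonneg-* : ∀ {x y} → Nonneg x → Nonneg y → Nonneg (x * y)
  nonneg-* {x} {y} x≥0 y≥0 -xy>0 = positive⇒nonzero -xy>0
      (trans (-‿cong (trans (*-congʳ x≈0) (zeroˡ y))) -0#≈0#)
    where
    x≈0 : x ≈ 0#
    x≈0 = connex
      (λ x>0 → positive⇒nonzero -xy>0 (trans (-‿cong (trans (*-congˡ
        (connex (λ y>0 → ¬opposite (-‿inverseʳ _) (positive-* x>0 y>0) -xy>0) y≥0)) (zeroʳ x))) -0#≈0#))
      x≥0

  nonneg-sum : ∀ {n} (f : Vector Carrier n) → (∀ i → Nonneg (f i)) → Nonneg (sum f)
  nonneg-sum {zero}  f f≥0 = nonneg-0
  nonneg-sum {suc n} f f≥0 = nonneg-+ (f≥0 zero) (nonneg-sum (f ∘ suc) (f≥0 ∘ suc))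

  square-nonneg : ∀ x → Nonneg (x * x)
  square-nonneg x -xx>0 = positive⇒nonzero -xx>0 (trans (-‿cong (trans (*-congʳ x≈0) (zeroˡ x))) -0#≈0#)
    where
    x≈0 : x ≈ 0#
    x≈0 = connex (λ x>0 → positive⇒nonneg (positive-* x>0 x>0) -xx>0)
      (λ -x>0 → positive⇒nonneg (positive-resp (solve 1 (λ x → :- x :* :- x := x :* x) refl x)
                                   (positive-* -x>0 -x>0)) -xx>0)

  -- Polynomial functions, seen through their iterated differences: one of these
  -- vanishes identically.
  data Polynomial : (Carrier → Carrier) → Set (c ⊔ ℓ) where
    vanishing  : ∀ {F} → (∀ s → F s ≈ 0#) → Polynomial F
    difference : ∀ {F} → Polynomial (λ s → F (s + 1#) - F s) → Polynomial F

  polynomial-cong : ∀ {F G} → (∀ s → F s ≈ G s) → Polynomial F → Polynomial G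
  polynomial-cong F≈G (vanishing F≈0)  = vanishing λ s → trans (sym (F≈G s)) (F≈0 s)
  polynomial-cong F≈G (difference ΔF) =
    difference (polynomial-cong (λ s → +-cong (F≈G _) (-‿cong (F≈G s))) ΔF)

  polynomial-+ : ∀ {F G} → Polynomial F → Polynomial G → Polynomial (λ s → F s + G s)
  polynomial-+ (vanishing F≈0) G-pol =
    polynomial-cong (λ s → sym (trans (+-congʳ (F≈0 s)) (+-identityˡ _))) G-pol
  polynomial-+ (difference ΔF) (vanishing G≈0) =
    polynomial-cong (λ s → sym (trans (+-congˡ (G≈0 s)) (+-identityʳ _))) (difference ΔF)
  polynomial-+ {F} {G} (difference ΔF) (difference ΔG) = difference (polynomial-cong
    (λ s → solve 4 (λ a b c d → a :- b :+ (c :- d) := a :+ c :- (b :+ d)) refl (F (s + 1#)) (F s) (G (s + 1#)) (G s))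
    (polynomial-+ ΔF ΔG))

  polynomial-scale : ∀ {F} a → Polynomial F → Polynomial (λ s → a * F s)
  polynomial-scale a (vanishing F≈0) = vanishing λ s → trans (*-congˡ (F≈0 s)) (zeroʳ a)
  polynomial-scale {F} a (difference ΔF) = difference (polynomial-cong
    (λ s → solve 3 (λ a f g → a :* (f :- g) := a :* f :- a :* g) refl a (F (s + 1#)) (F s))
    (polynomial-scale a ΔF))

  -- Discrete Leibniz rule: the difference of the product is the affine factor at `s + 1#` times the
  -- difference of `F`, plus `a * F s`. The recursion descends along the differences of `F` while
  -- `b` grows to `b + a`.
  polynomial-affine-* : ∀ {F} a b → Polynomial F → Polynomial (λ s → (s * a + b) * F s)
  polynomial-affine-* a b (vanishing F≈0) = vanishing λ s → trans (*-congˡ (F≈0 s)) (zeroʳ _)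
  polynomial-affine-* {F} a b (difference ΔF) = difference (polynomial-cong
    (λ s → trans
      (solve 5 (λ s a b f g → (s :* a :+ (b :+ a)) :* (f :- g) :+ a :* g
          := (s :* a :+ a :+ b) :* f :- (s :* a :+ b) :* g) refl s a b (F (s + 1#)) (F s))
      (+-congʳ (*-congʳ (+-congʳ (sym (trans (distribʳ a s 1#) (+-congˡ (*-identityˡ a))))))))
    (polynomial-+ (polynomial-affine-* a (b + a) ΔF) (polynomial-scale a (difference ΔF))))

  polynomial-const : ∀ a → Polynomial (λ _ → a)
  polynomial-const a = difference (vanishing λ _ → -‿inverseʳ a)

  polynomial-sum : ∀ {n} {F : Fin n → Carrier → Carrier} → (∀ j → Polynomial (F j)) →
                   Polynomial (λ s → ∑[ j < n ] F j s)
  polynomial-sum {zero}  F-pol = polynomial-const 0#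
  polynomial-sum {suc n} F-pol = polynomial-+ (F-pol zero) (polynomial-sum (F-pol ∘ suc))

  polynomial-det : ∀ {n} (A B : Matrix Carrier n) → Polynomial (λ s → det λ i k → s * A i k + B i k)
  polynomial-det {zero}  A B = polynomial-const 1#
  polynomial-det {suc n} A B = polynomial-sum λ j → polynomial-cong
    (λ s → sym (*-assoc (sign j) (s * A zero j + B zero j) (minor j s)))
    (polynomial-scale (sign j) (polynomial-affine-* (A zero j) (B zero j) (polynomial-det (minorOf j A) (minorOf j B))))
    where
    minorOf : Fin (suc n) → Matrix Carrier (suc n) → Matrix Carrier n
    minorOf j M i k = M (suc i) (punchIn j k)
    minor : Fin (suc n) → Carrier → Carrier
    minor j s = det λ i k → s * A (suc i) (punchIn j k) + B (suc i) (punchIn j k)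

  polynomial-product : ∀ {n} (μ : Vector Carrier n) → Polynomial (λ s → product λ i → s - μ i)
  polynomial-product {zero}  μ = polynomial-const 1#
  polynomial-product {suc n} μ = polynomial-cong (λ s → *-congʳ (+-congʳ (*-identityʳ s)))
    (polynomial-affine-* 1# (- μ zero) (polynomial-product (μ ∘ suc)))

  -- With `1#` added outermost, the difference taken at `shift k s` involves `shift (suc k) s` by
  -- definition.
  shift : ℕ → Carrier → Carrier
  shift zero    s = s
  shift (suc k) s = shift k s + 1#

  -- Backward extrapolation: zeros at all later points pass to the differences, so by recursion the
  -- difference at `s` vanishes and `F s` equals `F (s + 1#)`.
  polynomial-zero : ∀ {F} → Polynomial F → ∀ s → (∀ k → F (shift (suc k) s) ≈ 0#) → F s ≈ 0#
  polynomial-zero (vanishing F≈0) s _ = F≈0 s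
  polynomial-zero {F} (difference ΔF) s zeros = begin
    F s                              ≈⟨ solve 2 (λ f g → f := g :- (g :- f)) refl (F s) (F (s + 1#)) ⟩
    F (s + 1#) - (F (s + 1#) - F s)  ≈⟨ +-cong (zeros 0) (-‿cong (polynomial-zero ΔF s λ k →
                                          trans (+-cong (zeros (suc k)) (-‿cong (zeros k))) (-‿inverseʳ 0#))) ⟩
    0# - 0#                          ≈⟨ -‿inverseʳ 0# ⟩
    0#                               ∎

  -- Only the point `s ≈ a` is in doubt. The later points `s + 1#`, `s + 1# + 1#` and so on exceed
  -- `a` by positive amounts, so `F` vanishes there and `polynomial-zero` reaches back to `s`.
  polynomial-cancel : ∀ {F a} → Polynomial F → (∀ s → (s - a) * F s ≈ 0#) → ∀ s → F s ≈ 0#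
  polynomial-cancel {F} {a} F-pol h s = stable λ Fs≉0 →
    let s-a≈0 = no-zero-divisors (trans (*-comm _ _) (h s)) Fs≉0 in
    Fs≉0 (polynomial-zero F-pol s λ k →
      no-zero-divisors (h (shift (suc k) s)) (positive⇒nonzero (shifted s-a≈0 k)))
    where
    step : ∀ s → s - a + 1# ≈ s + 1# - a
    step s = solve 3 (λ s a o → s :- a :+ o := s :+ o :- a) refl s a 1#
    shifted : s - a ≈ 0# → ∀ k → Positive (shift (suc k) s - a)
    shifted s-a≈0 zero    = positive-resp (sym (trans (sym (step s)) (trans (+-congʳ s-a≈0) (+-identityˡ 1#)))) positive-1
    shifted s-a≈0 (suc k) = positive-resp (step _) (positive-+ (shifted s-a≈0 k) positive-1)

  -- Null vectors of singular matrices

  Injective : ∀ {m n} → (Fin m → Row n) → Set (c ⊔ ℓ)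
  Injective {n = n} M = ∀ (x : Row n) → (∀ i → ∑[ k < n ] (M i k * x k) ≈ 0#) → ∀ k → x k ≈ 0#

  ·-assoc-column : ∀ {l m n} (M : Fin l → Row m) (N : Fin m → Row n) (x : Row n) i →
    ∑[ j < m ] (M i j * ∑[ k < n ] (N j k * x k)) ≈ ∑[ k < n ] ((M · N) i k * x k)
  ·-assoc-column {m = m} {n} M N x i = begin
    ∑[ j < m ] (M i j * ∑[ k < n ] (N j k * x k))
      ≈⟨ sum-cong-≋ (λ j → *-distribˡ-sum (M i j) λ k → N j k * x k) ⟩
    ∑[ j < m ] ∑[ k < n ] (M i j * (N j k * x k))
      ≈⟨ ∑-comm (λ j k → M i j * (N j k * x k)) ⟩
    ∑[ k < n ] ∑[ j < m ] (M i j * (N j k * x k))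
      ≈⟨ sum-cong-≋ (λ k → trans (sum-cong-≋ λ j → sym (*-assoc (M i j) (N j k) (x k)))
                                 (sym (*-distribʳ-sum (x k) λ j → M i j * N j k))) ⟩
    ∑[ k < n ] ((M · N) i k * x k) ∎

  sum-pick′ : ∀ {n} k (x : Row n) → ∑[ j < n ] (I k j * x j) ≈ x k
  sum-pick′ k x = trans (sum-cong-≋ λ j → trans (*-comm (I k j) (x j)) (*-congˡ (I-sym k j))) (sum-pick x k)

  -- Pairing the cofactors with row i gives the determinant with its first row replaced
  -- by row i, which has two equal rows unless i is zero.
  cofactors-annihilated : ∀ {n} (M : Matrix Carrier (suc n)) → det M ≈ 0# → ∀ i →
    ∑[ j < suc n ] (M i j * (sign j * det λ i k → M (suc i) (punchIn j k))) ≈ 0#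
  cofactors-annihilated {n} M detM≈0 i = trans
    (sum-cong-≋ λ j → solve 3 (λ m e d → m :* (e :* d) := e :* m :* d) refl (M i j) (sign j) (minor j))
    (expansion i)
    where
    minor : Fin (suc n) → Carrier
    minor j = det λ i k → M (suc i) (punchIn j k)
    expansion : ∀ i → det (M i ∷ M ∘ suc) ≈ 0#
    expansion zero    = trans (sym (det-cong (η M))) detM≈0
    expansion (suc i) = vanish det-alternating {N = M ∘ suc} i ≋-refl

  -- Exhibiting a null vector would require deciding which entries vanish; refuting injectivity does
  -- not. The cofactors of the first row are annihilated, so injectivity makes the corner minor
  -- singular, and that minor is shown to be injective as well.
  kernel : ∀ {n} (M : Matrix Carrier n) → det M ≈ 0# → ¬ Injective M
  kernel {zero}  M 1≈0    inj = positive⇒nonzero positive-1 1≈0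
  kernel {suc n} M detM≈0 inj = kernel (λ i k → M (suc i) (suc k)) minor≈0 minor-inj
    where
    minor≈0 : det (λ i k → M (suc i) (suc k)) ≈ 0#
    minor≈0 = trans (sym (*-identityˡ _)) (inj (λ j → sign j * det λ i k → M (suc i) (punchIn j k)) (cofactors-annihilated M detM≈0) zero)

    -- If M zero p is not zero, the columns of E clear the rest of the first row.
    module Pivot p (M₀p≉0 : ¬ M zero p ≈ 0#) where
      F : Fin (suc n) → Row n
      F l b = M zero p * I (punchIn p b) l - M zero (punchIn p b) * I p l
      E : Matrix Carrier (suc n)
      E l zero    = I p l
      E l (suc b) = F l b

      ME-zero : (M · E) zero zero ≈ M zero p
      ME-zero = trans (sum-cong-≋ λ l → *-congˡ {M zero l} (I-sym p l)) (sum-pick (M zero) p)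

      MF : ∀ i b → (M · F) i b ≈ M zero p * M i (punchIn p b) - M zero (punchIn p b) * M i p
      MF i b = begin
        ∑[ l < suc n ] (M i l * (M zero p * I (punchIn p b) l - M zero (punchIn p b) * I p l))
          ≈⟨ sum-cong-≋ (λ l → solve 5 (λ m a e c f → m :* (a :* e :- c :* f) := a :* (e :* m) :+ :- c :* (f :* m))
               refl (M i l) (M zero p) (I (punchIn p b) l) (M zero (punchIn p b)) (I p l)) ⟩
        ∑[ l < suc n ] (M zero p * (I (punchIn p b) l * M i l) + - M zero (punchIn p b) * (I p l * M i l))
          ≈⟨ ∑-distrib-+ (λ l → M zero p * (I (punchIn p b) l * M i l)) (λ l → - M zero (punchIn p b) * (I p l * M i l)) ⟩
        ∑[ l < suc n ] (M zero p * (I (punchIn p b) l * M i l)) + ∑[ l < suc n ] (- M zero (punchIn p b) * (I p l * M i l))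
          ≈⟨ +-cong (*-distribˡ-sum (M zero p) λ l → I (punchIn p b) l * M i l)
                    (*-distribˡ-sum (- M zero (punchIn p b)) λ l → I p l * M i l) ⟨
        M zero p * ∑[ l < suc n ] (I (punchIn p b) l * M i l) + - M zero (punchIn p b) * ∑[ l < suc n ] (I p l * M i l)
          ≈⟨ +-cong (*-congˡ (sum-pick′ (punchIn p b) (M i))) (trans (*-congˡ (sum-pick′ p (M i))) (sym (-‿distribˡ-* _ _))) ⟩
        M zero p * M i (punchIn p b) - M zero (punchIn p b) * M i p ∎

      MF-zero : ∀ b → (M · F) zero b ≈ 0#
      MF-zero b = trans (MF zero b) (trans (+-congˡ (-‿cong (*-comm _ _))) (-‿inverseʳ _))

      reduced : Matrix Carrier n
      reduced i b = (M · F) (suc i) b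

      reduced-singular : det reduced ≈ 0#
      reduced-singular = no-zero-divisors (begin
        (M · E) zero zero * det reduced  ≈⟨ det-block (M · E) MF-zero ⟨
        det (M · E)                      ≈⟨ det-· M E ⟩
        det M * det E                    ≈⟨ trans (*-congʳ detM≈0) (zeroˡ _) ⟩
        0#                               ∎) (λ ME≈0 → M₀p≉0 (trans (sym ME-zero) ME≈0))

      reduced-injective : Injective reduced
      reduced-injective x Mx≈0 b = no-zero-divisors (begin
        M zero p * x b
          ≈⟨ *-congˡ (trans (sum-cong-≋ λ a → *-congʳ (I-punchIn²′ a)) (sum-pick′ b x)) ⟨
        M zero p * ∑[ a < n ] (I (punchIn p a) (punchIn p b) * x a)
          ≈⟨ *-distribˡ-sum (M zero p) (λ a → I (punchIn p a) (punchIn p b) * x a) ⟩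
        ∑[ a < n ] (M zero p * (I (punchIn p a) (punchIn p b) * x a))
          ≈⟨ sum-cong-≋ entry ⟨
        ∑[ a < n ] (F (punchIn p b) a * x a)
          ≈⟨ inj (λ l → ∑[ a < n ] (F l a * x a)) annihilated (punchIn p b) ⟩
        0# ∎) M₀p≉0
        where
        I-punchIn²′ : ∀ a → I (punchIn p a) (punchIn p b) ≈ I b a
        I-punchIn²′ a = trans (I-punchIn² p a b) (I-sym a b)
        entry : ∀ a → F (punchIn p b) a * x a ≈ M zero p * (I (punchIn p a) (punchIn p b) * x a)
        entry a = trans (*-congʳ (trans (+-congˡ (trans (-‿cong (trans (*-congˡ (I-punchIn p b)) (zeroʳ _))) -0#≈0#)) (+-identityʳ _)))
                        (*-assoc _ _ _)
        annihilated : ∀ i → ∑[ l < suc n ] (M i l * ∑[ a < n ] (F l a * x a)) ≈ 0#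
        annihilated zero    = trans (·-assoc-column M F x zero) (sum-zero _ λ a → trans (*-congʳ (MF-zero a)) (zeroˡ _))
        annihilated (suc i) = trans (·-assoc-column M F x (suc i)) (Mx≈0 i)

    minor-inj : Injective (λ i k → M (suc i) (suc k))
    minor-inj x Mx≈0 k = inj (0# ∷ x) annihilated (suc k)
      where
      -- A non-zero entry would serve as a pivot and yield a smaller matrix that is both singular
      -- and injective. With the first row zero, a null vector of the minor extends by `0#` to one
      -- of `M`.
      first-row : ∀ p → M zero p ≈ 0#
      first-row p = stable λ M₀p≉0 → let open Pivot p M₀p≉0 in
        kernel reduced reduced-singular reduced-injective
      annihilated : ∀ i → M i zero * 0# + ∑[ k < n ] (M i (suc k) * x k) ≈ 0#
      annihilated zero    = trans (+-cong (zeroʳ _) (sum-zero _ λ k → trans (*-congʳ (first-row (suc k))) (zeroˡ _))) (+-identityˡ 0#)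
      annihilated (suc i) = trans (+-cong (zeroʳ _) (Mx≈0 i)) (+-identityˡ 0#)

  -- Bilinear forms, pencils and Gram matrices

  bil : ∀ {m n} → (Fin m → Row n) → Row m → Row n → Carrier
  bil {m} {n} M x y = ∑[ i < m ] (x i * ∑[ k < n ] (M i k * y k))

  dot-linear : ∀ {n} (c : Row n) → Linear λ x → ∑[ i < n ] (x i * c i)
  dot-linear c = component-linear zero ∘-linear rowTimes-linear {n = 1} (λ j _ → c j)

  bil-linearˡ : ∀ {m n} (M : Fin m → Row n) y → Linear λ x → bil M x y
  bil-linearˡ M y = dot-linear _

  bil-linearʳ : ∀ {m n} (M : Fin m → Row n) x → Linear (bil M x)
  bil-linearʳ M x = sum-linear _ x λ i → sum-linear _ (M i) component-linear

  Symmetric : ∀ {n} → Matrix Carrier n → Set ℓ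
  Symmetric M = ∀ i k → M i k ≈ M k i

  bil-sym : ∀ {n} {M : Matrix Carrier n} → Symmetric M → ∀ x y → bil M x y ≈ bil M y x
  bil-sym {n} {M} M-sym x y = begin
    ∑[ i < n ] (x i * ∑[ k < n ] (M i k * y k))
      ≈⟨ sum-cong-≋ (λ i → *-distribˡ-sum (x i) λ k → M i k * y k) ⟩
    ∑[ i < n ] ∑[ k < n ] (x i * (M i k * y k))
      ≈⟨ ∑-comm (λ i k → x i * (M i k * y k)) ⟩
    ∑[ k < n ] ∑[ i < n ] (x i * (M i k * y k))
      ≈⟨ sum-cong-≋ (λ k → sum-cong-≋ λ i → trans (*-congˡ (*-congʳ (M-sym i k)))
           (solve 3 (λ x m y → x :* (m :* y) := y :* (m :* x)) refl (x i) (M k i) (y k))) ⟩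
    ∑[ k < n ] ∑[ i < n ] (y k * (M k i * x i))
      ≈⟨ sum-cong-≋ (λ k → *-distribˡ-sum (y k) λ i → M k i * x i) ⟨
    ∑[ k < n ] (y k * ∑[ i < n ] (M k i * x i)) ∎

  pencil : ∀ {n} → Matrix Carrier n → Matrix Carrier n → Carrier → Matrix Carrier n
  pencil A B s i k = s * B i k - A i k

  bil-pencil : ∀ {n} (A B : Matrix Carrier n) s x y →
               bil (pencil A B s) x y ≈ s * bil B x y - bil A x y
  bil-pencil {n} A B s x y = begin
    ∑[ i < n ] (x i * ∑[ k < n ] ((s * B i k - A i k) * y k))
      ≈⟨ sum-cong-≋ (λ i → *-congˡ (inner i)) ⟩
    ∑[ i < n ] (x i * (s * Bx i + - 1# * Ax i))
      ≈⟨ sum-cong-≋ (λ i → solve 5 (λ x s o b a → x :* (s :* b :+ :- o :* a) := s :* (x :* b) :+ :- o :* (x :* a)) refl (x i) s 1# (Bx i) (Ax i)) ⟩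
    ∑[ i < n ] (s * (x i * Bx i) + - 1# * (x i * Ax i))
      ≈⟨ ∑-distrib-+ (λ i → s * (x i * Bx i)) (λ i → - 1# * (x i * Ax i)) ⟩
    ∑[ i < n ] (s * (x i * Bx i)) + ∑[ i < n ] (- 1# * (x i * Ax i))
      ≈⟨ +-cong (*-distribˡ-sum s λ i → x i * Bx i) (*-distribˡ-sum (- 1#) λ i → x i * Ax i) ⟨
    s * bil B x y + - 1# * bil A x y
      ≈⟨ +-congˡ (-1*x≈-x _) ⟩
    s * bil B x y - bil A x y ∎
    where
    Ax Bx : Fin n → Carrier
    Ax i = ∑[ k < n ] (A i k * y k)
    Bx i = ∑[ k < n ] (B i k * y k)
    inner : ∀ i → ∑[ k < n ] ((s * B i k - A i k) * y k) ≈ s * Bx i + - 1# * Ax i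
    inner i = begin
      ∑[ k < n ] ((s * B i k - A i k) * y k)
        ≈⟨ sum-cong-≋ (λ k → trans (solve 4 (λ s b a y → (s :* b :- a) :* y := s :* (b :* y) :- (a :* y)) refl s (B i k) (A i k) (y k))
                                   (+-congˡ (sym (-1*x≈-x _)))) ⟩
      ∑[ k < n ] (s * (B i k * y k) + - 1# * (A i k * y k))
        ≈⟨ ∑-distrib-+ (λ k → s * (B i k * y k)) (λ k → - 1# * (A i k * y k)) ⟩
      ∑[ k < n ] (s * (B i k * y k)) + ∑[ k < n ] (- 1# * (A i k * y k))
        ≈⟨ +-cong (*-distribˡ-sum s λ k → B i k * y k) (*-distribˡ-sum (- 1#) λ k → A i k * y k) ⟨
      s * Bx i + - 1# * Ax i ∎

  combination : ∀ {m n} → (Fin m → Row n) → Row m → Row n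
  combination {m} W x k = ∑[ a < m ] (x a * W a k)

  gram : ∀ {m n} → Matrix Carrier n → (Fin m → Row n) → Matrix Carrier m
  gram M W a b = bil M (W a) (W b)

  bil-gram : ∀ {m n} (M : Matrix Carrier n) (W : Fin m → Row n) x y →
             bil (gram M W) x y ≈ bil M (combination W x) (combination W y)
  bil-gram {m} M W x y = sym (begin
    bil M (combination W x) (combination W y)
      ≈⟨ Linear.sum-homo (bil-linearˡ M (combination W y)) x W ⟩
    ∑[ a < m ] (x a * bil M (W a) (combination W y))
      ≈⟨ sum-cong-≋ (λ a → *-congˡ (trans (Linear.sum-homo (bil-linearʳ M (W a)) y W)
           (sum-cong-≋ λ b → *-comm (y b) (gram M W a b)))) ⟩
    bil (gram M W) x y ∎)

  det-gram : ∀ {n} (M W : Matrix Carrier n) → det (gram M W) ≈ det W * (det M * det (λ k a → W a k))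
  det-gram M W = trans (det-· W (M · λ k a → W a k)) (*-congˡ (det-· M (λ k a → W a k)))

  -- Were the sum not positive, `connex` would make it zero and `- y` would equal the positive `x`.
  -- The double negation costs nothing, as every use aims at a contradiction.
  positive-+-nonneg : ∀ {x y} → Positive x → Nonneg y → ¬ ¬ Positive (x + y)
  positive-+-nonneg {x} {y} x>0 y≥0 ¬x+y>0 = y≥0 (positive-resp x≈-y x>0)
    where
    x+y≈0 : x + y ≈ 0#
    x+y≈0 = connex ¬x+y>0 λ -x-y>0 → y≥0 (positive-resp
      (solve 2 (λ x y → x :- (x :+ y) := :- y) refl x y) (positive-+ x>0 -x-y>0))
    x≈-y : x ≈ - y
    x≈-y = trans (solve 2 (λ x y → x := :- y :+ (x :+ y)) refl x y) (trans (+-congˡ x+y≈0) (+-identityʳ _))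

  positive-square : ∀ {x} → ¬ x ≈ 0# → ¬ ¬ Positive (x * x)
  positive-square x≉0 ¬xx>0 = x≉0 (connex
    (λ x>0 → ¬xx>0 (positive-* x>0 x>0))
    (λ -x>0 → ¬xx>0 (positive-resp (solve 1 (λ x → :- x :* :- x := x :* x) refl _) (positive-* -x>0 -x>0))))

  -- The contrapositive form concludes equations, which are stable, instead of positivity, which
  -- would demand a witness.
  PositiveDefinite : ∀ {n} → Matrix Carrier n → Set (c ⊔ ℓ ⊔ p)
  PositiveDefinite {n} B = ∀ (x : Row n) → ¬ Positive (bil B x x) → ∀ k → x k ≈ 0#

  bil-orthogonal : ∀ {n} {M : Matrix Carrier n} → Symmetric M → ∀ a x b y → bil M x y ≈ 0# →
    let z = λ k → a * x k + b * y k in bil M z z ≈ a * a * bil M x x + b * b * bil M y y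
  bil-orthogonal {M = M} M-sym a x b y xy≈0 = begin
    bil M z z
      ≈⟨ expandʳ z ⟩
    a * bil M z x + b * bil M z y
      ≈⟨ +-cong (*-congˡ (expandˡ x)) (*-congˡ (expandˡ y)) ⟩
    a * (a * bil M x x + b * bil M y x) + b * (a * bil M x y + b * bil M y y)
      ≈⟨ +-cong (*-congˡ (+-congˡ (trans (*-congˡ (trans (bil-sym M-sym y x) xy≈0)) (zeroʳ b))))
                (*-congˡ (+-congʳ (trans (*-congˡ xy≈0) (zeroʳ a)))) ⟩
    a * (a * bil M x x + 0#) + b * (0# + b * bil M y y)
      ≈⟨ +-cong (trans (*-congˡ (+-identityʳ _)) (sym (*-assoc a a _)))
                (trans (*-congˡ (+-identityˡ _)) (sym (*-assoc b b _))) ⟩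
    a * a * bil M x x + b * b * bil M y y ∎
    where
    z : Row _
    z k = a * x k + b * y k
    expandʳ : ∀ u → bil M u z ≈ a * bil M u x + b * bil M u y
    expandʳ u = trans (Linear.comb (bil-linearʳ M u) (λ k → a * x k) b y)
                      (+-congʳ (Linear.scale (bil-linearʳ M u) a x))
    expandˡ : ∀ u → bil M z u ≈ a * bil M x u + b * bil M y u
    expandˡ u = trans (Linear.comb (bil-linearˡ M u) (λ k → a * x k) b y)
                      (+-congʳ (Linear.scale (bil-linearˡ M u) a x))

  -- Splits an eigenvector v off the pencil: the rows w span the B-orthogonal
  -- complement of v, and the pencil is congruent to ((s − μ₀) β) ⊕ (s B′ − A′).
  module Deflation {n} {A B : Matrix Carrier (suc n)} (A-sym : Symmetric A) (B-sym : Symmetric B)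
                   (B-def : PositiveDefinite B) {μ₀ v} (eigen : ∀ x → bil A x v ≈ μ₀ * bil B x v)
                   {p} (vₚ≉0 : ¬ v p ≈ 0#) where
    β : Carrier
    β = bil B v v

    ¬¬β>0 : ¬ ¬ Positive β
    ¬¬β>0 ¬β>0 = vₚ≉0 (B-def v ¬β>0 p)

    β≉0 : ¬ β ≈ 0#
    β≉0 β≈0 = ¬¬β>0 λ β>0 → positive⇒nonzero β>0 β≈0

    g : Row n
    g a = bil B v (I (punchIn p a))

    -- Gram-Schmidt without division: `β` times a basis vector, minus its component along `v`. The
    -- basis vector at `p` is left out because `v`, with `v p` non-zero, takes its place.
    w : Fin n → Row (suc n)
    w a k = β * I (punchIn p a) k + - g a * v k

    W : Matrix Carrier (suc n)
    W = v ∷ w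

    A′ B′ : Matrix Carrier n
    A′ = gram A w
    B′ = gram B w

    w-orthogonal : ∀ a → bil B v (w a) ≈ 0#
    w-orthogonal a = begin
      bil B v (w a)
        ≈⟨ Linear.comb (bil-linearʳ B v) (λ k → β * I (punchIn p a) k) (- g a) v ⟩
      bil B v (λ k → β * I (punchIn p a) k) + - g a * β
        ≈⟨ +-congʳ (Linear.scale (bil-linearʳ B v) β (I (punchIn p a))) ⟩
      β * g a + - g a * β
        ≈⟨ solve 2 (λ β g → β :* g :+ :- g :* β := g :* β :- g :* β) refl β (g a) ⟩
      g a * β - g a * β
        ≈⟨ -‿inverseʳ _ ⟩
      0# ∎

    combination-orthogonal : ∀ x → bil B v (combination w x) ≈ 0#
    combination-orthogonal x = trans (Linear.sum-homo (bil-linearʳ B v) x w)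
      (sum-zero _ λ a → trans (*-congˡ (w-orthogonal a)) (zeroʳ _))

    -- At coordinate `p` only the multiple of `v` survives, so its coefficient `G` vanishes;
    -- coordinate `punchIn p a` then reads `β * x a`.
    combination-injective : ∀ x → (∀ k → combination w x k ≈ 0#) → ∀ a → x a ≈ 0#
    combination-injective x wx≈0 a = no-zero-divisors (begin
      β * x a
        ≈⟨ *-congˡ (trans (sum-cong-≋ λ b → *-congˡ {x b} (I-punchIn² p b a)) (sum-pick x a)) ⟨
      β * X (punchIn p a)
        ≈⟨ trans (+-congˡ (trans (*-congʳ (trans (-‿cong G≈0) -0#≈0#)) (zeroˡ _))) (+-identityʳ _) ⟨
      β * X (punchIn p a) + - G * v (punchIn p a)
        ≈⟨ combination-expand (punchIn p a) ⟨
      combination w x (punchIn p a)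
        ≈⟨ wx≈0 (punchIn p a) ⟩
      0# ∎) β≉0
      where
      X : Row (suc n)
      X k = ∑[ a < n ] (x a * I (punchIn p a) k)
      G : Carrier
      G = ∑[ a < n ] (x a * g a)
      combination-expand : ∀ k → combination w x k ≈ β * X k + - G * v k
      combination-expand k = begin
        ∑[ a < n ] (x a * (β * I (punchIn p a) k + - g a * v k))
          ≈⟨ sum-cong-≋ (λ a → solve 5 (λ x β i g v → x :* (β :* i :+ :- g :* v) := β :* (x :* i) :+ :- v :* (x :* g))
               refl (x a) β (I (punchIn p a) k) (g a) (v k)) ⟩
        ∑[ a < n ] (β * (x a * I (punchIn p a) k) + - v k * (x a * g a))
          ≈⟨ ∑-distrib-+ (λ a → β * (x a * I (punchIn p a) k)) (λ a → - v k * (x a * g a)) ⟩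
        ∑[ a < n ] (β * (x a * I (punchIn p a) k)) + ∑[ a < n ] (- v k * (x a * g a))
          ≈⟨ +-cong (*-distribˡ-sum β λ a → x a * I (punchIn p a) k) (*-distribˡ-sum (- v k) λ a → x a * g a) ⟨
        β * X k + - v k * G
          ≈⟨ +-congˡ (solve 2 (λ v g → :- v :* g := :- g :* v) refl (v k) G) ⟩
        β * X k + - G * v k ∎
      X-p : X p ≈ 0#
      X-p = sum-zero _ λ a → trans (*-congˡ (trans (I-sym _ p) (I-punchIn p a))) (zeroʳ _)
      G≈0 : G ≈ 0#
      G≈0 = no-zero-divisors (begin
        v p * G
          ≈⟨ solve 2 (λ v g → v :* g := :- (:- g :* v)) refl (v p) G ⟩
        - (- G * v p)
          ≈⟨ -‿cong (trans (+-congʳ (trans (*-congˡ X-p) (zeroʳ β))) (+-identityˡ _)) ⟨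
        - (β * X p + - G * v p)
          ≈⟨ -‿cong (trans (sym (combination-expand p)) (wx≈0 p)) ⟩
        - 0#
          ≈⟨ -0#≈0# ⟩
        0# ∎) vₚ≉0

    -- The congruence brings in the determinants of `W` and of its transpose; `kernel` makes each
    -- non-zero, given injectivity of each. Here pairing with `v` under `B` isolates `x zero`.
    Wᵀ-injective : Injective (λ k a → W a k)
    Wᵀ-injective x Wx≈0 = λ { zero → x₀≈0 ; (suc a) → combination-injective (x ∘ suc) wx≈0 a }
      where
      Wx : ∀ k → combination w (x ∘ suc) k + x zero * v k ≈ 0#
      Wx k = trans (+-comm _ _) (trans (+-cong (*-comm _ _) (sum-cong-≋ λ a → *-comm (x (suc a)) (w a k))) (Wx≈0 k))
      x₀≈0 : x zero ≈ 0#
      x₀≈0 = no-zero-divisors (begin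
        β * x zero
          ≈⟨ *-comm _ _ ⟩
        x zero * β
          ≈⟨ trans (+-congʳ (combination-orthogonal (x ∘ suc))) (+-identityˡ _) ⟨
        bil B v (combination w (x ∘ suc)) + x zero * β
          ≈⟨ Linear.comb (bil-linearʳ B v) (combination w (x ∘ suc)) (x zero) v ⟨
        bil B v (λ k → combination w (x ∘ suc) k + x zero * v k)
          ≈⟨ Linear.zero-homo (bil-linearʳ B v) Wx ⟩
        0# ∎) β≉0
      wx≈0 : ∀ k → combination w (x ∘ suc) k ≈ 0#
      wx≈0 k = trans (sym (trans (+-congˡ (trans (*-congʳ x₀≈0) (zeroˡ _))) (+-identityʳ _))) (Wx k)

    W-injective : Injective W
    W-injective y Wy≈0 k = by-view (view p k)
      where
      y-other : ∀ a → y (punchIn p a) ≈ 0#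
      y-other a = no-zero-divisors (begin
        β * y (punchIn p a)
          ≈⟨ *-congˡ (sum-pick′ (punchIn p a) y) ⟨
        β * ∑[ k < suc n ] (I (punchIn p a) k * y k)
          ≈⟨ Linear.scale (dot-linear y) β (I (punchIn p a)) ⟨
        ∑[ k < suc n ] (β * I (punchIn p a) k * y k)
          ≈⟨ trans (+-congˡ (trans (*-congˡ (Wy≈0 zero)) (zeroʳ _))) (+-identityʳ _) ⟨
        ∑[ k < suc n ] (β * I (punchIn p a) k * y k) + - g a * ∑[ k < suc n ] (v k * y k)
          ≈⟨ Linear.comb (dot-linear y) (λ k → β * I (punchIn p a) k) (- g a) v ⟨
        ∑[ k < suc n ] (w a k * y k)
          ≈⟨ Wy≈0 (suc a) ⟩
        0# ∎) β≉0
      by-view : ∀ {k} → View p k → y k ≈ 0#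
      by-view (other a) = y-other a
      by-view same = no-zero-divisors (begin
        v p * y p
          ≈⟨ trans (+-congˡ (sum-zero _ λ a → trans (*-congˡ (y-other a)) (zeroʳ _))) (+-identityʳ _) ⟨
        v p * y p + ∑[ a < n ] (v (punchIn p a) * y (punchIn p a))
          ≈⟨ sum-remove {i = p} (λ k → v k * y k) ⟨
        ∑[ k < suc n ] (v k * y k)
          ≈⟨ Wy≈0 zero ⟩
        0# ∎) vₚ≉0

    B′-def : PositiveDefinite B′
    B′-def x ¬xx>0 = combination-injective x (B-def (combination w x)
      λ h → ¬xx>0 (positive-resp (sym (bil-gram B w x x)) h))

    -- The Gram matrix of the rows of `W` has a first row that is zero off the corner: `v` is
    -- B-orthogonal to every `w b`, and hence A-orthogonal, being an eigenvector.
    det-congruence : ∀ s → det W * (det (pencil A B s) * det (λ k a → W a k)) ≈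
                     (s - μ₀) * β * det (pencil A′ B′ s)
    det-congruence s = begin
      det W * (det (pencil A B s) * det (λ k a → W a k))
        ≈⟨ det-gram (pencil A B s) W ⟨
      det (gram (pencil A B s) W)
        ≈⟨ det-block (gram (pencil A B s) W) row ⟩
      bil (pencil A B s) v v * det (gram (pencil A B s) w)
        ≈⟨ *-cong corner (det-cong λ a b → bil-pencil A B s (w a) (w b)) ⟩
      (s - μ₀) * β * det (pencil A′ B′ s) ∎
      where
      corner : bil (pencil A B s) v v ≈ (s - μ₀) * β
      corner = begin
        bil (pencil A B s) v v  ≈⟨ bil-pencil A B s v v ⟩
        s * β - bil A v v       ≈⟨ +-congˡ (-‿cong (eigen v)) ⟩
        s * β - μ₀ * β          ≈⟨ solve 3 (λ s μ β → s :* β :- μ :* β := (s :- μ) :* β) refl s μ₀ β ⟩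
        (s - μ₀) * β            ∎
      row : ∀ b → bil (pencil A B s) v (w b) ≈ 0#
      row b = begin
        bil (pencil A B s) v (w b)
          ≈⟨ bil-pencil A B s v (w b) ⟩
        s * bil B v (w b) - bil A v (w b)
          ≈⟨ +-congˡ (-‿cong (trans (bil-sym A-sym v (w b)) (trans (eigen (w b)) (*-congˡ (bil-sym B-sym (w b) v))))) ⟩
        s * bil B v (w b) - μ₀ * bil B v (w b)
          ≈⟨ solve 3 (λ s μ β → s :* β :- μ :* β := (s :- μ) :* β) refl s μ₀ (bil B v (w b)) ⟩
        (s - μ₀) * bil B v (w b)
          ≈⟨ trans (*-congˡ (w-orthogonal b)) (zeroʳ _) ⟩
        0# ∎

    -- Scalars are cross-multiplied, never divided out. The difference of the two sides is a
    -- polynomial whose product with `s - μ₀` vanishes by `det-congruence` and `spectrum`, so the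
    -- factor cancels even at `s ≈ μ₀`.
    det-deflated : ∀ {k c} (μ : Vector Carrier n) →
      (∀ s → k * det (pencil A B s) ≈ c * ((s - μ₀) * product λ i → s - μ i)) →
      ∀ s → k * β * det (pencil A′ B′ s) ≈ c * (det W * det (λ k a → W a k)) * product λ i → s - μ i
    det-deflated {k} {c} μ spectrum s = begin
      k * β * D s                     ≈⟨ solve 2 (λ x y → x := x :- y :+ y) refl (k * β * D s) (c * V * Π s) ⟩
      k * β * D s - c * V * Π s + c * V * Π s
        ≈⟨ +-congʳ (trans (+-congˡ (-‿distribˡ-* _ _)) (polynomial-cancel {a = μ₀} F-polynomial F-zero s)) ⟩
      0# + c * V * Π s                ≈⟨ +-identityˡ _ ⟩
      c * V * Π s                     ∎
      where
      D Π : Carrier → Carrier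
      D s = det (pencil A′ B′ s)
      Π s = product λ i → s - μ i
      V U : Carrier
      U = det (λ k a → W a k)
      V = det W * U
      F-polynomial : Polynomial (λ s → k * β * D s + - (c * V) * Π s)
      F-polynomial = polynomial-+ (polynomial-scale (k * β) (polynomial-det B′ λ i k → - A′ i k))
                                  (polynomial-scale (- (c * V)) (polynomial-product μ))
      F-zero : ∀ s → (s - μ₀) * (k * β * D s + - (c * V) * Π s) ≈ 0#
      F-zero s = begin
        (s - μ₀) * (k * β * D s + - (c * V) * Π s)
          ≈⟨ solve 8 (λ σ k β d c x y π → σ :* (k :* β :* d :+ :- (c :* (x :* y)) :* π)
               := k :* (σ :* β :* d) :- x :* y :* (c :* (σ :* π))) refl (s - μ₀) k β (D s) c (det W) U (Π s) ⟩
        k * ((s - μ₀) * β * D s) - det W * U * (c * ((s - μ₀) * Π s))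
          ≈⟨ +-cong (*-congˡ (sym (det-congruence s))) (-‿cong (*-congˡ (sym (spectrum s)))) ⟩
        k * (det W * (det (pencil A B s) * U)) - det W * U * (k * det (pencil A B s))
          ≈⟨ solve 4 (λ k w d u → k :* (w :* (d :* u)) :- w :* u :* (k :* d) := k :- k) refl k (det W) (det (pencil A B s)) U ⟩
        k - k
          ≈⟨ -‿inverseʳ k ⟩
        0# ∎

  -- Induction on n, splitting off an eigenvector for μ zero together
  -- with one linear functional that does not vanish on it.
  eigenvalues-bounded-on-subspace : ∀ {n j} {A B : Matrix Carrier n} → Symmetric A → Symmetric B →
    PositiveDefinite B → ∀ {k c} → ¬ k ≈ 0# → ¬ c ≈ 0# → (μ : Vector Carrier n) →
    (∀ s → k * det (pencil A B s) ≈ c * product λ i → s - μ i) →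
    ∀ t → (f : Fin j → Row n → Carrier) → (∀ i → Linear (f i)) →
    (∀ x → (∀ i → f i x ≈ 0#) → ¬ Positive (bil A x x - t * bil B x x)) →
    j ℕ.< n → ¬ (∀ i → toℕ i ℕ.≤ j → Positive (μ i - t))
  eigenvalues-bounded-on-subspace {suc n} {j} {A} {B} A-sym B-sym B-def {k} {c} k≉0 c≉0 μ spectrum
    t f f-lin f-bound j<n μ>t = kernel (pencil A B μ₀) singular
      -- `kernel` is contradicted by proving every null vector zero: a non-zero coordinate of `v`
      -- makes it an eigenvector, which `split` refutes.
      λ v null p → stable λ vₚ≉0 → split v null vₚ≉0
    where
    μ₀ : Carrier
    μ₀ = μ zero

    singular : det (pencil A B μ₀) ≈ 0#
    singular = no-zero-divisors (trans (spectrum μ₀) (trans (*-congˡ (trans (*-congʳ (-‿inverseʳ μ₀)) (zeroˡ _))) (zeroʳ c))) k≉0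

    split : ∀ v → (∀ i → ∑[ k < suc n ] (pencil A B μ₀ i k * v k) ≈ 0#) → ∀ {p} → ¬ ¬ v p ≈ 0#
    split v null vₚ≉0 = ¬¬β>0 λ β>0 →
      -- At `v` the form takes the positive value `(μ₀ - t) * β`, which `f-bound` forbids as soon as
      -- all functionals vanish at `v`.
      f-bound v (f-vanishes j f f-lin f-bound j<n μ>t) (v-positive β>0)
      where
      eigen : ∀ x → bil A x v ≈ μ₀ * bil B x v
      eigen x = begin
        bil A x v
          ≈⟨ solve 2 (λ a b → a := b :- (b :- a)) refl (bil A x v) (μ₀ * bil B x v) ⟩
        μ₀ * bil B x v - (μ₀ * bil B x v - bil A x v)
          ≈⟨ +-congˡ (-‿cong (trans (sym (bil-pencil A B μ₀ x v)) (sum-zero _ λ i → trans (*-congˡ {x i} (null i)) (zeroʳ (x i))))) ⟩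
        μ₀ * bil B x v - 0#
          ≈⟨ trans (+-congˡ -0#≈0#) (+-identityʳ _) ⟩
        μ₀ * bil B x v ∎

      open Deflation A-sym B-sym B-def {v = v} eigen vₚ≉0

      v-positive : Positive β → Positive (bil A v v - t * β)
      v-positive β>0 = positive-resp
        (trans (solve 3 (λ μ t β → (μ :- t) :* β := μ :* β :- t :* β) refl μ₀ t β) (+-congʳ (sym (eigen v))))
        (positive-* (μ>t zero ℕ.z≤n) β>0)

      f-vanishes : ∀ j (f : Fin j → Row (suc n) → Carrier) → (∀ i → Linear (f i)) →
        (∀ x → (∀ i → f i x ≈ 0#) → ¬ Positive (bil A x x - t * bil B x x)) →
        j ℕ.< suc n → (∀ i → toℕ i ℕ.≤ j → Positive (μ i - t)) → ∀ i → f i v ≈ 0#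
      -- A functional with `f i v` non-zero is traded for the eigenvalue `μ zero`: dimension and
      -- number of functionals both drop by one, and the entries of `μ ∘ suc` up to the new `j`
      -- still exceed `t`.
      f-vanishes (suc j) f f-lin f-bound (ℕ.s≤s j<n) μ>t i = stable λ a≉0 →
        eigenvalues-bounded-on-subspace
          (λ a b → bil-sym A-sym (w a) (w b)) (λ a b → bil-sym B-sym (w a) (w b)) B′-def
          (*-nonzero k≉0 β≉0)
          (*-nonzero c≉0 (*-nonzero (λ det≈0 → kernel W det≈0 W-injective)
                                    (λ det≈0 → kernel (λ k a → W a k) det≈0 Wᵀ-injective)))
          (μ ∘ suc) (det-deflated (μ ∘ suc) spectrum)
          t (λ b → f (punchIn i b) ∘ T) (λ b → f-lin (punchIn i b) ∘-linear T-linear) (bound a≉0)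
          j<n (λ i i≤j → μ>t (suc i) (ℕ.s≤s i≤j))
        where
        a : Carrier
        a = f i v
        e : Row n → Carrier
        e x = - f i (combination w x)
        -- The multiple of `v` is chosen so that `f i` vanishes at `T x`; scaling the other part by
        -- `a` avoids dividing by `f i v`.
        T : Row n → Row (suc n)
        T x k = a * combination w x k + e x * v k
        X-linear : LinearMap (combination w)
        X-linear = rowTimes-linear w
        fX : Linear (f i ∘ combination w)
        fX = f-lin i ∘-linear X-linear
        T-linear : LinearMap T
        T-linear = record
          { cong = λ x≋y k → +-cong (*-congˡ (LinearMap.cong X-linear x≋y k)) (*-congʳ (-‿cong (Linear.cong fX x≋y)))
          ; comb = λ x b y k → trans
              (+-cong (*-congˡ (LinearMap.comb X-linear x b y k)) (*-congʳ (-‿cong (Linear.comb fX x b y))))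
              (solve 7 (λ a b x y p q v → a :* (x :+ b :* y) :+ :- (p :+ b :* q) :* v
                 := a :* x :+ :- p :* v :+ b :* (a :* y :+ :- q :* v)) refl
                 a b (combination w x k) (combination w y k) (f i (combination w x)) (f i (combination w y)) (v k))
          }
        f-T : ∀ x → (∀ b → f (punchIn i b) (T x) ≈ 0#) → ∀ {l} → View i l → f l (T x) ≈ 0#
        f-T x h (other b) = h b
        f-T x h same = begin
          f i (T x)
            ≈⟨ Linear.comb (f-lin i) (λ k → a * combination w x k) (e x) v ⟩
          f i (λ k → a * combination w x k) + e x * a
            ≈⟨ +-congʳ (Linear.scale (f-lin i) a (combination w x)) ⟩
          a * f i (combination w x) + e x * a
            ≈⟨ solve 2 (λ a f → a :* f :+ :- f :* a := a :- a) refl a (f i (combination w x)) ⟩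
          a - a
            ≈⟨ -‿inverseʳ a ⟩
          0# ∎
        bound : ¬ a ≈ 0# → ∀ x → (∀ b → f (punchIn i b) (T x) ≈ 0#) →
                ¬ Positive (bil A′ x x - t * bil B′ x x)
        bound a≉0 x fTx≈0 q>0 = ¬¬β>0 λ β>0 → positive-square a≉0 λ aa>0 →
          positive-+-nonneg (positive-* aa>0 q>0)
            (nonneg-* (square-nonneg (e x)) (positive⇒nonneg (v-positive β>0)))
            λ h → f-bound (T x) (λ l → f-T x fTx≈0 (view i l)) (positive-resp quadratic h)
          where
          X : Row (suc n)
          X = combination w x
          BXv : bil B X v ≈ 0#
          BXv = trans (bil-sym B-sym X v) (combination-orthogonal x)
          -- There are no mixed terms, because `X` is B-orthogonal and hence A-orthogonal to `v`. A
          -- positive value of the deflated form would thus make the form positive at `T x`, up to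
          -- double negation.
          quadratic : a * a * (bil A′ x x - t * bil B′ x x) + e x * e x * (bil A v v - t * β)
                      ≈ bil A (T x) (T x) - t * bil B (T x) (T x)
          quadratic = begin
            a * a * (bil A′ x x - t * bil B′ x x) + e x * e x * (bil A v v - t * β)
              ≈⟨ +-congʳ (*-congˡ (+-cong (bil-gram A w x x) (-‿cong (*-congˡ (bil-gram B w x x))))) ⟩
            a * a * (bil A X X - t * bil B X X) + e x * e x * (bil A v v - t * β)
              ≈⟨ solve 7 (λ a e t p q r s → a :* a :* (p :- t :* q) :+ e :* e :* (r :- t :* s)
                   := a :* a :* p :+ e :* e :* r :- t :* (a :* a :* q :+ e :* e :* s)) refl
                   a (e x) t (bil A X X) (bil B X X) (bil A v v) β ⟩
            (a * a * bil A X X + e x * e x * bil A v v) - t * (a * a * bil B X X + e x * e x * β)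
              ≈⟨ +-cong (bil-orthogonal A-sym a X (e x) v (trans (eigen X) (trans (*-congˡ BXv) (zeroʳ _))))
                        (-‿cong (*-congˡ (bil-orthogonal B-sym a X (e x) v BXv))) ⟨
            bil A (T x) (T x) - t * bil B (T x) (T x) ∎

  -- Eigenvalues against row sums

  I-positive-definite : ∀ {n} → PositiveDefinite (I {n})
  I-positive-definite {suc n} x ¬xx>0 k = stable λ xₖ≉0 → positive-square xₖ≉0 λ xₖ²>0 →
    positive-+-nonneg xₖ²>0 (nonneg-sum _ λ j → square-nonneg (x (punchIn k j))) λ sum>0 →
    ¬xx>0 (positive-resp (trans (sym (sum-remove {i = k} λ i → x i * x i))
                                (sum-cong-≋ λ i → *-congˡ {x i} (sym (sum-pick′ i x)))) sum>0)

  -- The Laplacian inequality 2 Lᵢₖ xᵢ xₖ ≤ Lᵢₖ (xᵢ² + xₖ²), summed over all pairs.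
  row-sum-bound : ∀ {n} {L : Matrix Carrier n} → Symmetric L → (∀ i k → Nonneg (L i k)) →
    ∀ (D : Vector Carrier n) → (∀ i → D i ≈ ∑[ k < n ] L i k) → ∀ t x →
    (∀ i → x i ≈ 0# ⊎ Nonneg (t - D i)) → ¬ Positive (bil L x x - t * bil I x x)
  row-sum-bound {n} {L} L-sym L≥0 D D≈ t x bound q>0 =
    -- Twice the form plus the non-negative `R′ + (U + U)` is zero by `total`; doubling avoids the
    -- factor one half of the Laplacian.
    positive-+-nonneg (positive-+ q>0 q>0)
      (nonneg-+ R≥0 (nonneg-+ U≥0 U≥0)) λ h → ¬positive-0 (positive-resp total h)
    where
    h₁ h₂ h₃ : Matrix Carrier n
    h₁ i k = L i k * (x i * x k)
    h₂ i k = L i k * (x i * x i)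
    h₃ i k = L i k * ((x i - x k) * (x i - x k))
    U H Q R′ S : Carrier
    U = ∑[ i < n ] ((t - D i) * (x i * x i))
    H = ∑[ i < n ] ∑[ k < n ] h₁ i k
    Q = ∑[ i < n ] ∑[ k < n ] h₂ i k
    R′ = ∑[ i < n ] ∑[ k < n ] h₃ i k
    S = ∑[ i < n ] (x i * x i)

    R≥0 : Nonneg R′
    R≥0 = nonneg-sum _ λ i → nonneg-sum _ λ k → nonneg-* (L≥0 i k) (square-nonneg _)

    U≥0 : Nonneg U
    U≥0 = nonneg-sum _ λ i → U-term i (bound i)
      where
      U-term : ∀ i → x i ≈ 0# ⊎ Nonneg (t - D i) → Nonneg ((t - D i) * (x i * x i))
      U-term i (inj₁ xᵢ≈0) = nonneg-resp (sym (trans (*-congˡ (trans (*-congʳ xᵢ≈0) (zeroˡ _))) (zeroʳ _))) nonneg-0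
      U-term i (inj₂ t≥D)  = nonneg-* t≥D (square-nonneg (x i))

    bil-H : bil L x x ≈ H
    bil-H = sum-cong-≋ λ i → trans (*-distribˡ-sum (x i) λ k → L i k * x k)
      (sum-cong-≋ λ k → solve 3 (λ a l b → a :* (l :* b) := l :* (a :* b)) refl (x i) (L i k) (x k))

    bil-S : bil I x x ≈ S
    bil-S = sum-cong-≋ λ i → *-congˡ {x i} (sum-pick′ i x)

    -- Symmetry of `L` makes the squares of `x k` a transposed copy of `h₂`, and exchanging the
    -- summations gives the second `Q`.
    sums : R′ + (H + H) ≈ Q + Q
    sums = begin
      R′ + (H + H)
        ≈⟨ +-congˡ (∑-distrib-+ (λ i → ∑[ k < n ] h₁ i k) (λ i → ∑[ k < n ] h₁ i k)) ⟨
      R′ + ∑[ i < n ] (∑[ k < n ] h₁ i k + ∑[ k < n ] h₁ i k)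
        ≈⟨ ∑-distrib-+ (λ i → ∑[ k < n ] h₃ i k) (λ i → ∑[ k < n ] h₁ i k + ∑[ k < n ] h₁ i k) ⟨
      ∑[ i < n ] (∑[ k < n ] h₃ i k + (∑[ k < n ] h₁ i k + ∑[ k < n ] h₁ i k))
        ≈⟨ sum-cong-≋ (λ i → trans (+-congˡ (sym (∑-distrib-+ (h₁ i) (h₁ i)))) (sym (∑-distrib-+ (h₃ i) (λ k → h₁ i k + h₁ i k)))) ⟩
      ∑[ i < n ] ∑[ k < n ] (h₃ i k + (h₁ i k + h₁ i k))
        ≈⟨ sum-cong-≋ (λ i → sum-cong-≋ λ k → trans
             (solve 3 (λ l a b → l :* ((a :- b) :* (a :- b)) :+ (l :* (a :* b) :+ l :* (a :* b))
                 := l :* (a :* a) :+ l :* (b :* b)) refl (L i k) (x i) (x k))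
             (+-congˡ (*-congʳ (L-sym i k)))) ⟩
      ∑[ i < n ] ∑[ k < n ] (h₂ i k + h₂ k i)
        ≈⟨ sum-cong-≋ (λ i → ∑-distrib-+ (h₂ i) (λ k → h₂ k i)) ⟩
      ∑[ i < n ] (∑[ k < n ] h₂ i k + ∑[ k < n ] h₂ k i)
        ≈⟨ ∑-distrib-+ (λ i → ∑[ k < n ] h₂ i k) (λ i → ∑[ k < n ] h₂ k i) ⟩
      Q + ∑[ i < n ] ∑[ k < n ] h₂ k i
        ≈⟨ +-congˡ (∑-comm (λ i k → h₂ k i)) ⟩
      Q + Q ∎

    U+Q : U + Q ≈ t * S
    U+Q = begin
      U + Q
        ≈⟨ ∑-distrib-+ (λ i → (t - D i) * (x i * x i)) (λ i → ∑[ k < n ] h₂ i k) ⟨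
      ∑[ i < n ] ((t - D i) * (x i * x i) + ∑[ k < n ] h₂ i k)
        ≈⟨ sum-cong-≋ (λ i → trans
             (+-congˡ (sym (trans (*-congʳ (D≈ i)) (*-distribʳ-sum (x i * x i) (L i)))))
             (solve 3 (λ t d y → (t :- d) :* y :+ d :* y := t :* y) refl t (D i) (x i * x i))) ⟩
      ∑[ i < n ] (t * (x i * x i))
        ≈⟨ *-distribˡ-sum t (λ i → x i * x i) ⟨
      t * S ∎

    total : (bil L x x - t * bil I x x) + (bil L x x - t * bil I x x) + (R′ + (U + U)) ≈ 0#
    total = begin
      (bil L x x - t * bil I x x) + (bil L x x - t * bil I x x) + (R′ + (U + U))
        ≈⟨ +-congʳ (+-cong q≈ q≈) ⟩
      (H - (U + Q)) + (H - (U + Q)) + (R′ + (U + U))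
        ≈⟨ solve 4 (λ h u q r → (h :- (u :+ q)) :+ (h :- (u :+ q)) :+ (r :+ (u :+ u)) := r :+ (h :+ h) :- (q :+ q)) refl H U Q R′ ⟩
      R′ + (H + H) - (Q + Q)
        ≈⟨ +-congʳ sums ⟩
      Q + Q - (Q + Q)
        ≈⟨ -‿inverseʳ (Q + Q) ⟩
      0# ∎
      where
      q≈ : bil L x x - t * bil I x x ≈ H - (U + Q)
      q≈ = +-cong bil-H (-‿cong (trans (*-congˡ bil-S) (sym U+Q)))

  scalar-I : ∀ {n} s (i k : Fin n) → scalar s i k ≈ s * I i k
  scalar-I s zero    zero    = sym (*-identityʳ s)
  scalar-I s zero    (suc k) = sym (zeroʳ s)
  scalar-I s (suc i) zero    = sym (zeroʳ s)
  scalar-I s (suc i) (suc k) = scalar-I s i k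

  -- Weyl's inequality for L ≤ diag D.
  eigenvalue-not-above-row-sum : ∀ {n} {L : Matrix Carrier n} → Symmetric L → (∀ i k → Nonneg (L i k)) →
    ∀ (D : Vector Carrier n) → (∀ i → D i ≈ ∑[ k < n ] L i k) →
    ∀ (μ : Vector Carrier n) → (∀ s → charPoly L s ≈ product λ i → s - μ i) →
    ∀ t (j : Fin n) (σ : Fin (toℕ j) → Fin n) → (∀ i → (∃[ b ] σ b ≡ i) ⊎ Nonneg (t - D i)) →
    ¬ (∀ i → i Fin.≤ j → Positive (μ i - t))
  eigenvalue-not-above-row-sum {L = L} L-sym L≥0 D D≈ μ spectrum t j σ large =
    eigenvalues-bounded-on-subspace L-sym I-sym I-positive-definite
      (positive⇒nonzero positive-1) (positive⇒nonzero positive-1) μ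
      (λ s → *-congˡ (trans (det-cong {M = pencil L I s} {N = λ i k → scalar s i k - L i k} λ i k → +-congʳ (sym (scalar-I s i k))) (spectrum s)))
      t (λ b x → x (σ b)) (λ b → component-linear (σ b))
      (λ x x≈0 → row-sum-bound L-sym L≥0 D D≈ t x λ i → split x x≈0 i (large i))
      (Fin.toℕ<n j)
    where
    split : ∀ x → (∀ b → x (σ b) ≈ 0#) → ∀ i → (∃[ b ] σ b ≡ i) ⊎ Nonneg (t - D i) → x i ≈ 0# ⊎ Nonneg (t - D i)
    split x x≈0 i (inj₁ (b , ≡.refl)) = inj₁ (x≈0 b)
    split x x≈0 i (inj₂ t≥D)          = inj₂ t≥D

-- The order of the real numbers

open import Defs

module RealOrder where
  open ℚ.≤-Reasoning
  open ℚ.+-*-Solver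

  -- The rational witness keeps the terms away from zero; positivity of each term alone would admit
  -- sequences tending to zero.
  Positive : ℝ → Set
  Positive x = ∃[ ε ] 0ℚ ℚ.< ε × Eventually λ n → ε ℚ.≤ seq x n

  p≤∣p∣ : ∀ p → p ℚ.≤ ℚ.∣ p ∣
  p≤∣p∣ p with ℚ.≤-total 0ℚ p
  ... | inj₁ 0≤p = ℚ.≤-reflexive (≡.sym (ℚ.0≤p⇒∣p∣≡p 0≤p))
  ... | inj₂ p≤0 = ℚ.≤-trans p≤0 (ℚ.0≤∣p∣ p)

  lower-bound : ∀ {ε p q} → ε ℚ.≤ p → ℚ.∣ p ℚ.- q ∣ ℚ.≤ ½ ℚ.* ε → ½ ℚ.* ε ℚ.≤ q
  lower-bound {ε} {p} {q} ε≤p near = begin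
    ½ ℚ.* ε
      ≡⟨ solve 1 (λ e → con ½ :* e := e :- con ½ :* e) ≡.refl ε ⟩
    ε ℚ.- ½ ℚ.* ε
      ≤⟨ ℚ.+-mono-≤ ε≤p (ℚ.neg-antimono-≤ (ℚ.≤-trans (p≤∣p∣ (p ℚ.- q)) near)) ⟩
    p ℚ.- (p ℚ.- q)
      ≡⟨ solve 2 (λ p q → p :- (p :- q) := q) ≡.refl p q ⟩
    q ∎

  positive-resp : ∀ {x y} → x ≈ y → Positive x → Positive y
  positive-resp {x} {y} x≈y (ε , 0<ε , ε≤x) = ½ ℚ.* ε , 0<½* 0<ε , eventually₂
    (λ {n} ε≤xₙ near → lower-bound {ε} {seq x n} {seq y n} ε≤xₙ (ℚ.<⇒≤ near))
    ε≤x (x≈y (½ ℚ.* ε) (0<½* 0<ε))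

  positive-+ : ∀ {x y} → Positive x → Positive y → Positive (x + y)
  positive-+ (ε , 0<ε , ε≤x) (δ , 0<δ , δ≤y) =
    ε ℚ.+ δ , ℚ.+-mono-< 0<ε 0<δ , eventually₂ ℚ.+-mono-≤ ε≤x δ≤y

  positive-* : ∀ {x y} → Positive x → Positive y → Positive (x * y)
  positive-* {x} {y} (ε , 0<ε , ε≤x) (δ , 0<δ , δ≤y) = ε ℚ.* δ , 0<εδ , eventually₂ εδ≤xy ε≤x δ≤y
    where
    0<εδ : 0ℚ ℚ.< ε ℚ.* δ
    0<εδ = ≡.subst (ℚ._< ε ℚ.* δ) (ℚ.*-zeroʳ ε) (ℚ.*-monoʳ-<-pos ε {{ℚ.positive 0<ε}} 0<δ)
    εδ≤xy : ∀ {n} → ε ℚ.≤ seq x n → δ ℚ.≤ seq y n → ε ℚ.* δ ℚ.≤ seq x n ℚ.* seq y n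
    εδ≤xy {n} ε≤xₙ δ≤yₙ = begin
      ε ℚ.* δ              ≤⟨ ℚ.*-monoʳ-≤-nonNeg δ {{ℚ.nonNegative (ℚ.<⇒≤ 0<δ)}} ε≤xₙ ⟩
      seq x n ℚ.* δ        ≤⟨ ℚ.*-monoˡ-≤-nonNeg (seq x n) {{ℚ.nonNegative (ℚ.≤-trans (ℚ.<⇒≤ 0<ε) ε≤xₙ)}} δ≤yₙ ⟩
      seq x n ℚ.* seq y n  ∎

  positive-1 : Positive (fromℚ 1ℚ)
  positive-1 = 1ℚ , ℚ.positive⁻¹ 1ℚ , 0 , λ _ _ → ℚ.≤-refl

  ¬positive-0 : ¬ Positive (fromℚ 0ℚ)
  ¬positive-0 (ε , 0<ε , N , ε≤0) = ℚ.<-irrefl ≡.refl (ℚ.<-≤-trans 0<ε (ε≤0 N ℕ.≤-refl))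

  -- Whether the bound holds can be decided on the rational term beyond which the
  -- sequence varies by less than ε / 4.
  ¬positive⇒eventually-≤ : ∀ x → ¬ Positive x → ∀ ε → 0ℚ ℚ.< ε → Eventually λ n → seq x n ℚ.≤ ε
  ¬positive⇒eventually-≤ x x≯0 ε 0<ε with cauchy x (½ ℚ.* (½ ℚ.* ε)) (0<½* (0<½* 0<ε))
  ... | N , near with ½ ℚ.* ε ℚ.≤? seq x N
  ...   | yes large = contradiction (½ ℚ.* (½ ℚ.* ε) , 0<½* (0<½* 0<ε) , N , λ n N≤n →
            lower-bound {p = seq x N} {seq x n} large (ℚ.<⇒≤ (near N n ℕ.≤-refl N≤n))) x≯0
  ...   | no small = N , λ n N≤n → begin
            seq x n
              ≡⟨ solve 2 (λ a b → a := b :+ (a :- b)) ≡.refl (seq x n) (seq x N) ⟩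
            seq x N ℚ.+ (seq x n ℚ.- seq x N)
              ≤⟨ ℚ.+-mono-≤ (ℚ.<⇒≤ (ℚ.≰⇒> small)) (ℚ.≤-trans (p≤∣p∣ (seq x n ℚ.- seq x N)) (ℚ.<⇒≤ (near n N N≤n ℕ.≤-refl))) ⟩
            ½ ℚ.* ε ℚ.+ ½ ℚ.* (½ ℚ.* ε)
              ≤⟨ ℚ.+-monoʳ-≤ (½ ℚ.* ε) (ℚ.*-monoˡ-≤-nonNeg ½ half≤) ⟩
            ½ ℚ.* ε ℚ.+ ½ ℚ.* ε
              ≡⟨ ½+½ ε ⟩
            ε ∎
    where
    half≤ : ½ ℚ.* ε ℚ.≤ ε
    half≤ = begin
      ½ ℚ.* ε              ≡⟨ ℚ.+-identityʳ _ ⟨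
      ½ ℚ.* ε ℚ.+ 0ℚ       ≤⟨ ℚ.+-monoʳ-≤ (½ ℚ.* ε) (ℚ.<⇒≤ (0<½* 0<ε)) ⟩
      ½ ℚ.* ε ℚ.+ ½ ℚ.* ε  ≡⟨ ½+½ ε ⟩
      ε                    ∎

  -- Each refutation bounds the terms eventually from one side. Asking for half of `ε` turns these
  -- weak bounds into the strict one in `≈`.
  connex : ∀ {x} → ¬ Positive x → ¬ Positive (- x) → x ≈ fromℚ 0ℚ
  connex {x} x≯0 -x≯0 ε 0<ε = eventually₂ bound
    (¬positive⇒eventually-≤ x x≯0 (½ ℚ.* ε) (0<½* 0<ε))
    (¬positive⇒eventually-≤ (- x) -x≯0 (½ ℚ.* ε) (0<½* 0<ε))
    where
    half< : ½ ℚ.* ε ℚ.< ε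
    half< = begin-strict
      ½ ℚ.* ε              ≡⟨ ℚ.+-identityʳ _ ⟨
      ½ ℚ.* ε ℚ.+ 0ℚ       <⟨ ℚ.+-monoʳ-< (½ ℚ.* ε) (0<½* 0<ε) ⟩
      ½ ℚ.* ε ℚ.+ ½ ℚ.* ε  ≡⟨ ½+½ ε ⟩
      ε                    ∎
    bound : ∀ {n} → seq x n ℚ.≤ ½ ℚ.* ε → ℚ.- seq x n ℚ.≤ ½ ℚ.* ε → ℚ.∣ seq x n ℚ.- 0ℚ ∣ ℚ.< ε
    bound {n} x≤ -x≤ with ℚ.∣p∣≡p∨∣p∣≡-p (seq x n)
    ... | inj₁ eq = ℚ.≤-<-trans (ℚ.≤-reflexive (≡.trans (≡.cong ℚ.∣_∣ (ℚ.+-identityʳ (seq x n))) eq)) (ℚ.≤-<-trans x≤ half<)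
    ... | inj₂ eq = ℚ.≤-<-trans (ℚ.≤-reflexive (≡.trans (≡.cong ℚ.∣_∣ (ℚ.+-identityʳ (seq x n))) eq)) (ℚ.≤-<-trans -x≤ half<)

  isOrderedDomain : IsOrderedDomain 0ℓ ℝ-commutativeRing
  isOrderedDomain = record
    { Positive = Positive
    ; positive-resp = λ {x} {y} → positive-resp {x} {y}
    ; positive-+ = λ {x} {y} → positive-+ {x} {y}
    ; positive-* = λ {x} {y} → positive-* {x} {y}
    ; positive-1 = positive-1
    ; ¬positive-0 = ¬positive-0
    ; connex = λ {x} → connex {x}
    }

  ¬positive⇒≤ : ∀ x y → ¬ Positive (x + - y) → x ≤ y
  ¬positive⇒≤ x y x-y≯0 ε 0<ε = let N , bound = ¬positive⇒eventually-≤ (x + - y) x-y≯0 ε 0<ε in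
    N , λ n N≤n → begin
      seq x n                            ≡⟨ solve 2 (λ a b → a := b :+ (a :- b)) ≡.refl (seq x n) (seq y n) ⟩
      seq y n ℚ.+ (seq x n ℚ.- seq y n)  ≤⟨ ℚ.+-monoʳ-≤ (seq y n) (bound n N≤n) ⟩
      seq y n ℚ.+ ε                      ∎

  positive-≤-trans : ∀ {x y} z → y ≤ x → Positive (y + - z) → Positive (x + - z)
  positive-≤-trans {x} {y} z y≤x (ε , 0<ε , ε≤y-z) = ½ ℚ.* ε , 0<½* 0<ε , eventually₂ bound ε≤y-z (y≤x (½ ℚ.* ε) (0<½* 0<ε))
    where
    bound : ∀ {n} → ε ℚ.≤ seq y n ℚ.- seq z n → seq y n ℚ.≤ seq x n ℚ.+ ½ ℚ.* ε → ½ ℚ.* ε ℚ.≤ seq x n ℚ.- seq z n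
    bound {n} ε≤ y≤ = begin
      ½ ℚ.* ε
        ≡⟨ solve 1 (λ e → con ½ :* e := e :- con ½ :* e) ≡.refl ε ⟩
      ε ℚ.- ½ ℚ.* ε
        ≤⟨ ℚ.+-monoˡ-≤ (ℚ.- (½ ℚ.* ε)) (ℚ.≤-trans ε≤ (ℚ.+-monoˡ-≤ (ℚ.- seq z n) y≤)) ⟩
      seq x n ℚ.+ ½ ℚ.* ε ℚ.- seq z n ℚ.- ½ ℚ.* ε
        ≡⟨ solve 3 (λ x e z → x :+ con ½ :* e :- z :- con ½ :* e := x :- z) ≡.refl (seq x n) ε (seq z n) ⟩
      seq x n ℚ.- seq z n ∎

-- The entries of the connection matrix

module SubsetSums where
  open import Data.Vec.Base using (here; []; _∷_; tabulate)
  open import Relation.Binary.PropositionalEquality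
  open SemiringSum (CommutativeRing.semiring ℤ.+-*-commutativeRing) using (sum; sum-cong-≗; sum-remove; sum-replicate-zero; ∑-distrib-+)
  open ℤ.+-*-Solver
  open ≡-Reasoning

  infix 4 _≟ˢ_
  _≟ˢ_ : ∀ {v} (s t : Subset v) → Dec (s ≡ t)
  _≟ˢ_ = ≡-dec Bool._≟_

  subsetSum : ∀ {v} → (Subset v → ℤ) → ℤ
  subsetSum {zero}  f = f []
  subsetSum {suc v} f = subsetSum (f ∘ (inside ∷_)) ℤ.+ subsetSum (f ∘ (outside ∷_))

  subsetSum-cong : ∀ {v} {f g : Subset v → ℤ} → f ≗ g → subsetSum f ≡ subsetSum g
  subsetSum-cong {zero}  f≗g = f≗g []
  subsetSum-cong {suc v} f≗g = cong₂ ℤ._+_ (subsetSum-cong (f≗g ∘ (inside ∷_))) (subsetSum-cong (f≗g ∘ (outside ∷_)))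

  subsetSum-zero : ∀ {v} → subsetSum {v} (λ _ → 0ℤ) ≡ 0ℤ
  subsetSum-zero {zero}  = refl
  subsetSum-zero {suc v} = cong₂ ℤ._+_ (subsetSum-zero {v}) (subsetSum-zero {v})

  subsetSum-neg : ∀ {v} (f : Subset v → ℤ) → subsetSum (λ s → ℤ.- f s) ≡ ℤ.- subsetSum f
  subsetSum-neg {zero}  f = refl
  subsetSum-neg {suc v} f = trans (cong₂ ℤ._+_ (subsetSum-neg (f ∘ (inside ∷_))) (subsetSum-neg (f ∘ (outside ∷_))))
    (sym (ℤ.neg-distrib-+ (subsetSum (f ∘ (inside ∷_))) _))

  subsetSum-+ : ∀ {v} (f g : Subset v → ℤ) → subsetSum (λ s → f s ℤ.+ g s) ≡ subsetSum f ℤ.+ subsetSum g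
  subsetSum-+ {zero}  f g = refl
  subsetSum-+ {suc v} f g = trans
    (cong₂ ℤ._+_ (subsetSum-+ (f ∘ (inside ∷_)) (g ∘ (inside ∷_))) (subsetSum-+ (f ∘ (outside ∷_)) (g ∘ (outside ∷_))))
    (solve 4 (λ a b c d → (a :+ b) :+ (c :+ d) := (a :+ c) :+ (b :+ d)) refl
      (subsetSum (f ∘ (inside ∷_))) (subsetSum (g ∘ (inside ∷_))) (subsetSum (f ∘ (outside ∷_))) (subsetSum (g ∘ (outside ∷_))))

  subsetSum-sum : ∀ {v n} (f : Fin n → Subset v → ℤ) →
                  sum (λ z → subsetSum (f z)) ≡ subsetSum (λ s → sum λ z → f z s)
  subsetSum-sum {v} {zero}  f = sym (subsetSum-zero {v})
  subsetSum-sum {v} {suc n} f = trans (cong (λ a → subsetSum (f zero) ℤ.+ a) (subsetSum-sum (f ∘ suc)))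
                                      (sym (subsetSum-+ (f zero) _))

  subsetSum-pick : ∀ {v} (t : Subset v) (f : Subset v → ℤ) →
                   subsetSum (λ s → if does (t ≟ˢ s) then f s else 0ℤ) ≡ f t
  subsetSum-pick [] f = refl
  subsetSum-pick {suc v} (inside ∷ t) f = trans
    (cong₂ ℤ._+_ (subsetSum-pick t (f ∘ (inside ∷_))) (subsetSum-zero {v})) (ℤ.+-identityʳ _)
  subsetSum-pick {suc v} (outside ∷ t) f = trans
    (cong₂ ℤ._+_ (subsetSum-zero {v}) (subsetSum-pick t (f ∘ (outside ∷_)))) (ℤ.+-identityˡ _)

  isEmpty : ∀ {v} → Subset v → ℤ
  isEmpty s = if does (Subset.⊥ ≟ˢ s) then 1ℤ else 0ℤ

  -- The summand `-1ℤ ^ ∣ s ∣` of the alternating sum over subsets of `t`, extended by zero to all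
  -- `s` and computed coordinatewise to match the recursion of `subsetSum`.
  signed : ∀ {v} → Subset v → Subset v → ℤ
  signed []            []            = 1ℤ
  signed (inside ∷ s)  (inside ∷ t)  = ℤ.- signed s t
  signed (inside ∷ s)  (outside ∷ t) = 0ℤ
  signed (outside ∷ s) (_ ∷ t)       = signed s t

  signed-⊆ : ∀ {v} (s t : Subset v) → s ⊆ t → signed s t ≡ -1ℤ ℤ.^ ∣ s ∣
  signed-⊆ [] [] _ = refl
  signed-⊆ (inside ∷ s) (inside ∷ t) s⊆t = trans
    (cong (λ a → ℤ.- a) (signed-⊆ s t (Subset.drop-∷-⊆ s⊆t))) (sym (ℤ.-1*i≡-i _))
  signed-⊆ (inside ∷ s) (outside ∷ t) s⊆t with () ← s⊆t here
  signed-⊆ (outside ∷ s) (_ ∷ t) s⊆t = signed-⊆ s t (Subset.drop-∷-⊆ s⊆t)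

  signed-⊈ : ∀ {v} (s t : Subset v) → ¬ s ⊆ t → signed s t ≡ 0ℤ
  signed-⊈ [] [] s⊈t = contradiction (λ ()) s⊈t
  signed-⊈ (inside ∷ s) (inside ∷ t) s⊈t = cong (λ a → ℤ.- a) (signed-⊈ s t (s⊈t ∘ Subset.in⊆in))
  signed-⊈ (inside ∷ s) (outside ∷ t) s⊈t = refl
  signed-⊈ (outside ∷ s) (_ ∷ t) s⊈t = signed-⊈ s t (s⊈t ∘ Subset.out⊆)

  -- At an element of `t` the subsets containing it cancel those without it. Only an empty `t`
  -- escapes, leaving the term of the empty set.
  subsetSum-signed : ∀ {v} (t : Subset v) →
    subsetSum (λ s → signed s t) ≡ 0ℤ ⊎ subsetSum (λ s → signed s t) ≡ 1ℤ
  subsetSum-signed [] = inj₂ refl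
  subsetSum-signed (inside ∷ t) = inj₁ (trans
    (cong (λ a → a ℤ.+ subsetSum (λ s → signed s t)) (subsetSum-neg λ s → signed s t)) (ℤ.+-inverseˡ (subsetSum λ s → signed s t)))
  subsetSum-signed {suc v} (outside ∷ t) = subst (λ a → a ≡ 0ℤ ⊎ a ≡ 1ℤ)
    (sym (trans (cong (λ a → a ℤ.+ subsetSum (λ s → signed s t)) (subsetSum-zero {v})) (ℤ.+-identityˡ _)))
    (subsetSum-signed t)

  if-zero : ∀ b → (if b then 0ℤ else 0ℤ) ≡ 0ℤ
  if-zero true  = refl
  if-zero false = refl

  sum-zeros : ∀ {n} (f : Fin n → ℤ) → (∀ i → f i ≡ 0ℤ) → sum f ≡ 0ℤ
  sum-zeros {n} f f≡0 = trans (sum-cong-≗ f≡0) (sum-replicate-zero n)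

  module _ {v n : ℕ} (G : SimplicialComplex v n) where
    open SimplicialComplex G

    sum-simplex : ∀ y a → sum (λ z → if does (simplex z ≟ˢ simplex y) then a else 0ℤ) ≡ a
    sum-simplex = go injective
      where
      -- The complex fixes `n`; keeping just an injective family allows matching on the number of
      -- simplices.
      go : ∀ {n} {simplex : Fin n → Subset v} → (∀ {i j} → simplex i ≡ simplex j → i ≡ j) →
           ∀ y a → sum (λ z → if does (simplex z ≟ˢ simplex y) then a else 0ℤ) ≡ a
      go {suc n} {simplex} injective y a = begin
        sum f
          ≡⟨ sum-remove {i = y} f ⟩
        f y ℤ.+ sum (f ∘ punchIn y)
          ≡⟨ cong₂ ℤ._+_ (cong (λ b → if b then a else 0ℤ) (dec-true (simplex y ≟ˢ simplex y) refl))
               (sum-zeros _ λ k → cong (λ b → if b then a else 0ℤ)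
                 (dec-false (simplex (punchIn y k) ≟ˢ simplex y) (Fin.punchInᵢ≢i y k ∘ injective))) ⟩
        a ℤ.+ 0ℤ
          ≡⟨ ℤ.+-identityʳ a ⟩
        a ∎
        where
        f : Fin (suc n) → ℤ
        f z = if does (simplex z ≟ˢ simplex y) then a else 0ℤ

    module _ (x y : Fin n) where
      private
        X = simplex x
        Y = simplex y

      -- `ω` on the common faces, extended from simplices to all subsets. Truncated subtraction
      -- gives the empty set the value 1, which never counts, as no simplex is empty.
      weight : Subset v → ℤ
      weight s = if does (s ⊆? X) ∧ does (s ⊆? Y) then -1ℤ ℤ.^ (∣ s ∣ ℕ.∸ 1) else 0ℤ

      weight-⊆ : ∀ s → s ⊆ X ∩ Y → weight s ≡ -1ℤ ℤ.^ (∣ s ∣ ℕ.∸ 1)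
      weight-⊆ s s⊆ = cong₂ (λ a b → if a ∧ b then -1ℤ ℤ.^ (∣ s ∣ ℕ.∸ 1) else 0ℤ)
        (dec-true (s ⊆? X) (Subset.p∩q⊆p X Y ∘ s⊆)) (dec-true (s ⊆? Y) (Subset.p∩q⊆q X Y ∘ s⊆))

      weight-⊈ : ∀ s → ¬ s ⊆ X ∩ Y → weight s ≡ 0ℤ
      weight-⊈ s s⊈ with s ⊆? X | s ⊆? Y
      ... | yes s⊆X | yes s⊆Y = ⊥-elim (s⊈ λ i∈s → Subset.x∈p∩q⁺ (s⊆X i∈s , s⊆Y i∈s))
      ... | yes _   | no _    = refl
      ... | no _    | _       = refl

      connection-weight : connection G x y ≡ sum (λ z → weight (simplex z))
      connection-weight = sum-cong-≗ λ z → cong (if_then ω G z else 0ℤ) (trans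
        (lookup-zipWith _∧_ z (C G x) (C G y))
        (cong₂ _∧_ (lookup∘tabulate (λ z → does (simplex z ⊆? X)) z) (lookup∘tabulate (λ z → does (simplex z ⊆? Y)) z)))

      -- A non-empty subset of x ∩ y is a simplex, by closedness; the empty set is
      -- subtracted separately.
      multiplicity : ∀ s → sum (λ z → if does (simplex z ≟ˢ s) then weight s else 0ℤ) ≡
                     isEmpty s ℤ.- signed s (X ∩ Y)
      multiplicity s with s ⊆? X ∩ Y
      ... | no s⊈ = trans
        (sum-zeros _ λ z → trans (cong (λ a → if does (simplex z ≟ˢ s) then a else 0ℤ) (weight-⊈ s s⊈)) (if-zero _))
        (sym (cong₂ ℤ._-_ (cong (λ b → if b then 1ℤ else 0ℤ) (dec-false (Subset.⊥ ≟ˢ s) λ { refl → s⊈ Subset.⊥⊆ }))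
                          (signed-⊈ s (X ∩ Y) s⊈)))
      ... | yes s⊆ with nonempty? s
      ...   | no empty rewrite Subset.Empty-unique empty = trans
        (sum-zeros _ λ z → cong (λ b → if b then weight Subset.⊥ else 0ℤ)
          (dec-false (simplex z ≟ˢ Subset.⊥) λ eq → let i , i∈z = nonempty z in Subset.∉⊥ (subst (i Subset.∈_) eq i∈z)))
        (sym (cong₂ ℤ._-_ (cong (λ b → if b then 1ℤ else 0ℤ) (dec-true (Subset.⊥ {v} ≟ˢ Subset.⊥) refl))
                          (trans (signed-⊆ Subset.⊥ (X ∩ Y) Subset.⊥⊆) (cong (λ k → -1ℤ ℤ.^ k) (Subset.∣⊥∣≡0 v)))))
      ...   | yes (i , i∈s) with closed x s (i , i∈s) (Subset.p∩q⊆p X Y ∘ s⊆)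
      ...     | y′ , refl = trans (sum-simplex y′ (weight s)) (trans (weight-⊆ s s⊆) (trans (shift (Subset.x∈p⇒∣p-x∣<∣p∣ i∈s))
        (sym (cong₂ ℤ._-_ (cong (λ b → if b then 1ℤ else 0ℤ) (dec-false (Subset.⊥ ≟ˢ s) λ eq → Subset.∉⊥ (subst (i Subset.∈_) (sym eq) i∈s)))
                          (signed-⊆ s (X ∩ Y) s⊆)))))
        where
        -- The exponent in `ω` is one less than the cardinality, whence the minus sign. The
        -- cardinality is positive because removing `i` lowers it.
        shift : ∀ {j k} → j ℕ.< k → -1ℤ ℤ.^ (k ℕ.∸ 1) ≡ 0ℤ ℤ.- -1ℤ ℤ.^ k
        shift {k = suc k} _ = solve 1 (λ a → a := con 0ℤ :- con -1ℤ :* a) refl (-1ℤ ℤ.^ k)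

      -- Passing from simplices to all subsets of the vertex set makes the alternating sum
      -- computable. The 1 corrects for the empty set, which that sum counts and the complex does
      -- not contain.
      connection-euler : connection G x y ≡ 1ℤ ℤ.- subsetSum (λ s → signed s (X ∩ Y))
      connection-euler = begin
        connection G x y
          ≡⟨ connection-weight ⟩
        sum (λ z → weight (simplex z))
          ≡⟨ sum-cong-≗ (λ z → subsetSum-pick (simplex z) weight) ⟨
        sum (λ z → subsetSum λ s → if does (simplex z ≟ˢ s) then weight s else 0ℤ)
          ≡⟨ subsetSum-sum (λ z s → if does (simplex z ≟ˢ s) then weight s else 0ℤ) ⟩
        subsetSum (λ s → sum λ z → if does (simplex z ≟ˢ s) then weight s else 0ℤ)
          ≡⟨ subsetSum-cong multiplicity ⟩
        subsetSum (λ s → isEmpty s ℤ.- signed s (X ∩ Y))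
          ≡⟨ subsetSum-+ {v} isEmpty (λ s → ℤ.- signed s (X ∩ Y)) ⟩
        subsetSum {v} isEmpty ℤ.+ subsetSum (λ s → ℤ.- signed s (X ∩ Y))
          ≡⟨ cong₂ ℤ._+_ (subsetSum-pick (Subset.⊥ {v}) λ _ → 1ℤ) (subsetSum-neg λ s → signed s (X ∩ Y)) ⟩
        1ℤ ℤ.- subsetSum (λ s → signed s (X ∩ Y)) ∎

      connection-0-1 : connection G x y ≡ 0ℤ ⊎ connection G x y ≡ 1ℤ
      connection-0-1 with subsetSum-signed (X ∩ Y)
      ... | inj₁ eq = inj₂ (trans connection-euler (cong (λ a → 1ℤ ℤ.- a) eq))
      ... | inj₂ eq = inj₁ (trans connection-euler (cong (λ a → 1ℤ ℤ.- a) eq))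

    connection-sym : ∀ x y → connection G x y ≡ connection G y x
    connection-sym x y = cong (χ G) (Subset.∩-comm (C G x) (C G y))

    degree-sum : ∀ x → ℤ.+ degree G x ≡ sum (connection G x)
    degree-sum x = count (connection G x) (connection-0-1 x)
      where
      count : ∀ {n} (f : Fin n → ℤ) → (∀ i → f i ≡ 0ℤ ⊎ f i ≡ 1ℤ) →
              ℤ.+ ∣ tabulate (λ y → does (¬? (f y ℤ.≟ 0ℤ))) ∣ ≡ sum f
      count {zero}  f f01 = refl
      count {suc n} f f01 with f zero | f01 zero
      ... | _ | inj₁ refl = trans (count (f ∘ suc) (f01 ∘ suc)) (sym (ℤ.+-identityˡ _))
      ... | _ | inj₂ refl = cong (λ a → 1ℤ ℤ.+ a) (count (f ∘ suc) (f01 ∘ suc))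

-- Integers and natural numbers inside the reals

-- Carried out on unnormalised fractions, where the denominator 1 stays visible and no reduction by
-- a common divisor intervenes.
/1-homo-+ : ∀ a b → (a ℤ.+ b) ℚ./ 1 ≡ a ℚ./ 1 ℚ.+ b ℚ./ 1
/1-homo-+ a b = ℚ.toℚᵘ-injective (begin-equality
  ℚ.toℚᵘ ((a ℤ.+ b) ℚ./ 1)                       ≃⟨ ℚ.toℚᵘ-fromℚᵘ (ℚᵘ.mkℚᵘ (a ℤ.+ b) 0) ⟩
  ℚᵘ.mkℚᵘ (a ℤ.+ b) 0                            ≃⟨ ℚᵘ.*≡* (≡.cong (ℤ._* 1ℤ) (≡.cong₂ ℤ._+_ (≡.sym (ℤ.*-identityʳ a)) (≡.sym (ℤ.*-identityʳ b)))) ⟩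
  ℚᵘ.mkℚᵘ a 0 ℚᵘ.+ ℚᵘ.mkℚᵘ b 0                   ≃⟨ ℚᵘ.+-cong (ℚ.toℚᵘ-fromℚᵘ (ℚᵘ.mkℚᵘ a 0)) (ℚ.toℚᵘ-fromℚᵘ (ℚᵘ.mkℚᵘ b 0)) ⟨
  ℚ.toℚᵘ (a ℚ./ 1) ℚᵘ.+ ℚ.toℚᵘ (b ℚ./ 1)         ≃⟨ ℚ.toℚᵘ-homo-+ (a ℚ./ 1) (b ℚ./ 1) ⟨
  ℚ.toℚᵘ (a ℚ./ 1 ℚ.+ b ℚ./ 1)                   ∎)
  where open ℚᵘ.≤-Reasoning

module _ where
  open CommutativeRing ℝ-commutativeRing using (setoid; +-congˡ)
  open OrderedDomain ℝ-commutativeRing RealOrder.isOrderedDomain using (Nonneg; nonneg-0; nonneg-+; positive⇒nonneg; nonneg-resp)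
  open SemiringSum (CommutativeRing.semiring ℝ-commutativeRing) using (sum)
  open SemiringSum (CommutativeRing.semiring ℤ.+-*-commutativeRing) using () renaming (sum to sumℤ)

  fromℤ-+ : ∀ a b → fromℤ (a ℤ.+ b) ≈ fromℤ a + fromℤ b
  fromℤ-+ a b = pointwise (fromℤ (a ℤ.+ b)) (fromℤ a + fromℤ b) λ _ → /1-homo-+ a b

  fromℤ-sum : ∀ {n} (f : Vector ℤ n) → fromℤ (sumℤ f) ≈ sum (fromℤ ∘ f)
  fromℤ-sum {zero}  f = pointwise (fromℤ 0ℤ) (fromℚ 0ℚ) λ _ → ≡.refl
  fromℤ-sum {suc n} f = ≈-trans {fromℤ (sumℤ f)} {fromℤ (f zero) + fromℤ (sumℤ (f ∘ suc))} {sum (fromℤ ∘ f)}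
    (fromℤ-+ (f zero) (sumℤ (f ∘ suc)))
    (+-congˡ {fromℤ (f zero)} {fromℤ (sumℤ (f ∘ suc))} {sum (fromℤ ∘ f ∘ suc)} (fromℤ-sum (f ∘ suc)))

  nonneg-1 : Nonneg (fromℤ 1ℤ)
  nonneg-1 = positive⇒nonneg {fromℚ 1ℚ} RealOrder.positive-1

  fromℕ-nonneg : ∀ m → Nonneg (fromℕ m)
  fromℕ-nonneg zero    = nonneg-0
  fromℕ-nonneg (suc m) = nonneg-resp {fromℤ 1ℤ + fromℕ m} {fromℕ (suc m)}
    (≈-sym {fromℕ (suc m)} {fromℤ 1ℤ + fromℕ m} (fromℤ-+ 1ℤ (ℤ.+ m)))
    (nonneg-+ {fromℤ 1ℤ} {fromℕ m} nonneg-1 (fromℕ-nonneg m))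

  fromℕ-mono : ∀ {k m} → k ℕ.≤ m → Nonneg (fromℕ m + - fromℕ k)
  fromℕ-mono {k} {m} k≤m = nonneg-resp {fromℕ (m ℕ.∸ k)} {fromℕ m + - fromℕ k}
    (pointwise (fromℕ (m ℕ.∸ k)) (fromℕ m + - fromℕ k) λ _ → difference) (fromℕ-nonneg (m ℕ.∸ k))
    where
    difference : ℤ.+ (m ℕ.∸ k) ℚ./ 1 ≡ ℤ.+ m ℚ./ 1 ℚ.- ℤ.+ k ℚ./ 1
    difference = begin
      ℤ.+ (m ℕ.∸ k) ℚ./ 1
        ≡⟨ solve 2 (λ a b → a := a :+ b :- b) ≡.refl (ℤ.+ (m ℕ.∸ k) ℚ./ 1) (ℤ.+ k ℚ./ 1) ⟩
      ℤ.+ (m ℕ.∸ k) ℚ./ 1 ℚ.+ ℤ.+ k ℚ./ 1 ℚ.- ℤ.+ k ℚ./ 1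
        ≡⟨ ≡.cong (ℚ._- ℤ.+ k ℚ./ 1) (/1-homo-+ (ℤ.+ (m ℕ.∸ k)) (ℤ.+ k)) ⟨
      ℤ.+ (m ℕ.∸ k ℕ.+ k) ℚ./ 1 ℚ.- ℤ.+ k ℚ./ 1
        ≡⟨ ≡.cong (λ a → ℤ.+ a ℚ./ 1 ℚ.- ℤ.+ k ℚ./ 1) (ℕ.m∸n+n≡m k≤m) ⟩
      ℤ.+ m ℚ./ 1 ℚ.- ℤ.+ k ℚ./ 1 ∎
      where
      open ≡.≡-Reasoning
      open ℚ.+-*-Solver

theorem1 : ∀ {v n : ℕ} (G : SimplicialComplex v n) →
    (μ : Vector ℝ n) → Eigenvalues (connectionMatrix G) μ → Antitonic₁ Fin._≤_ _≤_ μ →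
    (d : Vector ℕ n) → degree G ↭ d → Antitonic₁ Fin._≤_ ℕ._≤_ d →
    ∀ (j : Fin n) → μ j ≤ fromℕ (d j)
theorem1 {n = n} G μ spectrum μ-antitone d (ρ , degree≡d) d-antitone j =
  ¬positive⇒≤ (μ j) (fromℕ (d j)) λ μⱼ>dⱼ →
    OrderedDomain.eigenvalue-not-above-row-sum ℝ-commutativeRing isOrderedDomain
      {L = connectionMatrix G} symmetric (λ x y → entry-nonneg (SubsetSums.connection-0-1 G x y))
      (λ x → fromℕ (degree G x)) degree-row-sum μ spectrum (fromℕ (d j)) j
      -- `ρ` sends a position in the sorted list to a simplex, so these are the simplices at the
      -- positions before `j`, those of largest degree.
      (λ b → ρ ⟨$⟩ʳ Fin.inject b) small-or-listed
      -- The descending order of `μ` carries the supposed excess of `μ j` over `d j` to all earlier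
      -- eigenvalues.
      λ i i≤j → positive-≤-trans {μ i} {μ j} (fromℕ (d j)) (μ-antitone i≤j) μⱼ>dⱼ
  where
  open RealOrder using (¬positive⇒≤; positive-≤-trans; isOrderedDomain)
  open OrderedDomain ℝ-commutativeRing isOrderedDomain using (Nonneg; nonneg-0)
  open SemiringSum (CommutativeRing.semiring ℝ-commutativeRing) using (sum)

  symmetric : ∀ x y → connectionMatrix G x y ≈ connectionMatrix G y x
  symmetric x y = pointwise (connectionMatrix G x y) (connectionMatrix G y x)
    λ _ → ≡.cong (ℚ._/ 1) (SubsetSums.connection-sym G x y)

  entry-nonneg : ∀ {z} → z ≡ 0ℤ ⊎ z ≡ 1ℤ → Nonneg (fromℤ z)
  entry-nonneg (inj₁ ≡.refl) = nonneg-0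
  entry-nonneg (inj₂ ≡.refl) = nonneg-1

  degree-row-sum : ∀ x → fromℕ (degree G x) ≈ sum (connectionMatrix G x)
  degree-row-sum x = ≡.subst (λ z → fromℤ z ≈ sum (connectionMatrix G x))
    (≡.sym (SubsetSums.degree-sum G x)) (fromℤ-sum (connection G x))

  -- The position of `x` in the sorted list decides: before `j` it is listed, and from `j` on its
  -- degree is at most `d j` since `d` descends.
  small-or-listed : ∀ x → (∃[ b ] ρ ⟨$⟩ʳ Fin.inject {i = j} b ≡ x) ⊎ Nonneg (fromℕ (d j) + - fromℕ (degree G x))
  small-or-listed x = decide (toℕ (ρ ⟨$⟩ˡ x) ℕ.<? toℕ j)
    where
    decide : Dec (toℕ (ρ ⟨$⟩ˡ x) ℕ.< toℕ j) →
             (∃[ b ] ρ ⟨$⟩ʳ Fin.inject {i = j} b ≡ x) ⊎ Nonneg (fromℕ (d j) + - fromℕ (degree G x))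
    decide (yes k<j) = inj₁ (Fin.fromℕ< k<j , ≡.trans (≡.cong (ρ ⟨$⟩ʳ_) (Fin.toℕ-injective
      (≡.trans (Fin.toℕ-inject (Fin.fromℕ< k<j)) (Fin.toℕ-fromℕ< k<j)))) (inverseʳ ρ))
    decide (no k≮j) = inj₂ (fromℕ-mono (≡.subst (ℕ._≤ d j)
      (≡.trans (≡.sym (degree≡d (ρ ⟨$⟩ˡ x))) (≡.cong (degree G) (inverseʳ ρ))) (d-antitone (ℕ.≮⇒≥ k≮j))))
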